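{- Let $q\ge1$ and let $i_1,\dots,i_q$ be integers with $1\le i_1<\cdots<i_q\le 7$. Then there exists a $9$-dimensional integral polytope $\mathcal{P}$ such that the coefficients of $t^{i_1},\dots,t^{i_q}$ in $i(\mathcal{P},t)$ are negative, and all the remaining coefficients of $i(\mathcal{P},t)$ are positive.
   Context: An integral polytope is a convex polytope all of whose vertices have integer coordinates. For an integral polytope $\mathcal{P}\subseteq\mathbb{R}^N$ of dimension $d$, $i(\mathcal{P},t)=|t\mathcal{P}\cap\mathbb{Z}^N|$ ($t$ a positive integer) is a polynomial in $t$ of degree $d$, the Ehrhart polynomial. -}

module Defs where

open import Data.Nat as ℕ using (ℕ; zero; suc)
open import Data.Integer as ℤ using (ℤ; +_)
open import Data.Rational using (ℚ; _/_; 0ℚ; 1ℚ; _+_; _*_; _≤_; _<_)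
open import Data.Fin using (Fin; toℕ) renaming (zero to fz; suc to fs)
open import Data.Vec using (Vec; lookup)
open import Data.List using (List; length)
open import Data.List.Relation.Unary.Unique.Propositional using (Unique)
open import Data.List.Membership.Propositional using (_∈_)
open import Data.Product using (Σ; ∃; _×_; _,_)
open import Data.Empty using (⊥)
open import Relation.Binary.PropositionalEquality using (_≡_)
open import Function using (_∘_; _⇔_)
open import Relation.Nullary using (¬_)

Point : ℕ → Set
Point N = Vec ℤ N

ι : ℤ → ℚ
ι z = z / 1

Σℚ : {m : ℕ} → (Fin m → ℚ) → ℚ
Σℚ {zero} f = 0ℚ
Σℚ {suc m} f = f fz + Σℚ (f ∘ fs)

-- An integral polytope in ℝ^N: the convex hull of finitely many (m ≥ 1)
-- integer points.  Its vertices are among these points, hence integral;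
-- conversely every integral polytope is the hull of its vertices.
record IntegralPolytope (N : ℕ) : Set where
  field
    m   : ℕ
    gen : Fin (suc m) → Point N

open IntegralPolytope public

-- x ∈ t·P  (x an integer point; P the convex hull of gen):
-- x = t · Σ λ_i v_i with λ_i ≥ 0, Σ λ_i = 1 (rational λ suffice, as P is rational)
InDilate : {N : ℕ} → IntegralPolytope N → ℕ → Point N → Set
InDilate P t x =
  Σ (Fin (suc (m P)) → ℚ) λ c →
    (∀ i → 0ℚ ≤ c i) × (Σℚ c ≡ 1ℚ) ×
    (∀ j → ι (lookup x j) ≡ ι (+ t) * Σℚ (λ i → c i * ι (lookup (gen P i) j)))

LatticeCount : {N : ℕ} → IntegralPolytope N → ℕ → ℕ → Set
LatticeCount {N} P t n =
  Σ (List (Point N)) λ L →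
    Unique L × (∀ x → (x ∈ L) ⇔ InDilate P t x) × (length L ≡ n)

AffIndep : {N k : ℕ} → (Fin k → Point N) → Set
AffIndep {N} w =
  ∀ (μ : _ → ℚ) → Σℚ μ ≡ 0ℚ →
    (∀ j → Σℚ (λ i → μ i * ι (lookup (w i) j)) ≡ 0ℚ) → ∀ i → μ i ≡ 0ℚ

-- dim P = d : the affine hull of P (= of its generators) has dimension d,
-- i.e. the maximal number of affinely independent generators is d + 1
HasDim : {N : ℕ} → IntegralPolytope N → ℕ → Set
HasDim P d =
  (Σ (Fin (suc d) → Fin (suc (m P))) λ f → AffIndep (gen P ∘ f)) ×
  (∀ (f : Fin (suc (suc d)) → Fin (suc (m P))) → ¬ AffIndep (gen P ∘ f))

evalPoly : {d : ℕ} → (Fin (suc d) → ℚ) → ℕ → ℚ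
evalPoly c t = Σℚ (λ k → c k * ι (+ (t ℕ.^ toℕ k)))

IsEhrhart : {N d : ℕ} → IntegralPolytope N → (Fin (suc d) → ℚ) → Set
IsEhrhart P c = ∀ (t : ℕ) → Σ ℕ λ n → LatticeCount P (suc t) n × (ι (+ n) ≡ evalPoly c (suc t))

StrictlyIncreasing : {q : ℕ} → Vec ℕ q → Set
StrictlyIncreasing {q} v = ∀ (a b : Fin q) → toℕ a ℕ.< toℕ b → lookup v a ℕ.< lookup v b

{-# OPTIONS --safe #-}
module Submission where

-- Let Δ(M, w) be the simplex with vertices 0, (M, -w) and the unit vectors e_i, i ≥ 2.  Writing the
-- first coordinate of a lattice point of s Δ(M, w) as j + a₀ M with 0 ≤ j < M, these points correspond
-- to the pairs of j and a ∈ ℕ^d with l_j + Σ a ≤ s, where l_j is the round-up of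
-- (j + Σ_i (w_i j mod M)) / M.  So the Ehrhart polynomial of n Δ(M, w) is Σ_j C(n t - l_j + d, d), which
-- is computed by counting the j with each value of l_j.  Ehrhart polynomials of products multiply, and
-- for each of the 2⁷ sign patterns some product of such simplices has coefficients of these signs.

open import Defs
open import Algebra.Bundles using (CommutativeRing)
open import Data.Bool using (Bool; true; false; T; _∧_)
open import Data.Bool.Properties using (T-∧)
open import Data.Fin using (Fin; toℕ; punchIn; _↑ˡ_; _↑ʳ_; splitAt; combine; remQuot) renaming (zero to fz; suc to fs)
open import Data.Fin.Patterns
import Data.Fin.Properties as Finₚ
open import Data.Integer as ℤ using (ℤ; +_; -[1+_])
import Data.Integer.Properties as ℤₚ
import Data.Integer.Tactic.RingSolver as ℤSolver
open import Data.List as List using (List; []; _∷_; length; cartesianProductWith)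
open import Data.List.Membership.Propositional using (_∈_)
import Data.List.Membership.Propositional.Properties as ∈ₚ
import Data.List.Properties as Listₚ
open import Data.List.Relation.Unary.All using ([])
import Data.List.Relation.Unary.All.Properties as Allₚ
open import Data.List.Relation.Unary.AllPairs using ([]; _∷_)
import Data.List.Relation.Unary.AllPairs.Properties as AllPairsₚ
open import Data.List.Relation.Unary.Any using (here; there)
open import Data.List.Relation.Unary.Unique.Propositional using (Unique)
import Data.List.Relation.Unary.Unique.Propositional.Properties as Uniqueₚ
open import Data.Nat as ℕ using (ℕ; zero; suc; _≤_; _<_; z≤n; s≤s; _!)
import Data.Nat.DivMod as ℕᵈ
import Data.Nat.Properties as ℕₚ
import Data.Nat.Tactic.RingSolver as ℕSolver
open import Data.Product using (Σ; ∃; _×_; _,_; proj₁; proj₂)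
open import Data.Rational as ℚ using (ℚ; 0ℚ; 1ℚ) renaming (_<_ to _<ℚ_)
import Data.Rational.Properties as ℚₚ
import Data.Rational.Unnormalised as ℚᵘ
import Data.Rational.Unnormalised.Properties as ℚᵘₚ
open import Data.Sum using (inj₁; inj₂; [_,_]′)
open import Data.Vec as Vec using (Vec; lookup; []; _∷_; _++_)
open import Data.Vec.Functional using (insertAt)
import Data.Vec.Functional.Properties as VFₚ
import Data.Vec.Properties as Vecₚ
open import Function using (_∘_; _⇔_; mk⇔; Equivalence)
open import Relation.Binary.PropositionalEquality using (_≡_; _≢_; refl; sym; trans; cong; cong₂; subst; module ≡-Reasoning)
open import Relation.Nullary using (¬_; Dec; yes; no; contradiction; ¬?)
open import Relation.Nullary.Decidable using (does; dec-true; dec-false; dec⇒maybe)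
open import Algebra.Properties.AbelianGroup ℤₚ.+-0-abelianGroup using (∙-cancelʳ)
open import Algebra.Properties.Semiring.Sum (CommutativeRing.semiring ℚₚ.+-*-commutativeRing) using (sum; ∑-distrib-+; ∑-comm; sum-remove; *-distribˡ-sum)
open import Tactic.RingSolver using (solve-∀)
open import Tactic.RingSolver.Core.AlmostCommutativeRing using (AlmostCommutativeRing; fromCommutativeRing)

-- Negative coefficients come from factors such as `w = (1, M - 1)`. There `j + (j mod M) + ((M - 1)
-- j mod M) = M + j` for `0 < j < M`, so `l_j = 2`, as for Reeve's tetrahedra. For n = 1 the Ehrhart
-- polynomial is `(M t³ + 6 t² + (12 - M) t + 6) / 6`, with negative linear coefficient once M > 12.
-- Dilating a factor by n multiplies its coefficient of `t^k` by `n^k`, so the n of the several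
-- factors tune how strongly each degree enters the product. The range 1 to 7 cannot be enlarged:
-- the constant term of an Ehrhart polynomial is 1, the leading coefficient is a volume and the next
-- one is half of a boundary volume. As the dimension is fixed, existence is a finite check. To make
-- it feasible by evaluation, factorials are cleared so that all coefficients are integers, and a
-- simplex costs one pass over `j < M`, never an enumeration of lattice points.

ℚ-ring : AlmostCommutativeRing _ _
ℚ-ring = fromCommutativeRing ℚₚ.+-*-commutativeRing (λ x → dec⇒maybe (0ℚ ℚ.≟ x))

-- Sums of rationals and linear dependence

module _ where
  open import Data.Rational using (_+_; _*_; -_; _-_)

  -- `z / 1` normalises through a gcd that is stuck for open `z`. The proof therefore passes to
  -- unnormalised rationals, where `ι z` is equivalent to `z` over 1 and only a ring identity in ℤ
  -- remains.
  ι-homo-+ : ∀ a b → ι (a ℤ.+ b) ≡ ι a + ι b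
  ι-homo-+ a b = ℚₚ.toℚᵘ-injective (begin
    ℚ.toℚᵘ (ι (a ℤ.+ b))                  ≈⟨ ℚₚ.toℚᵘ-fromℚᵘ (ℚᵘ.mkℚᵘ (a ℤ.+ b) 0) ⟩
    ℚᵘ.mkℚᵘ (a ℤ.+ b) 0                   ≈⟨ ℚᵘ.*≡* (eq a b) ⟩
    ℚᵘ.mkℚᵘ a 0 ℚᵘ.+ ℚᵘ.mkℚᵘ b 0          ≈⟨ ℚᵘₚ.+-cong (ℚₚ.toℚᵘ-fromℚᵘ (ℚᵘ.mkℚᵘ a 0)) (ℚₚ.toℚᵘ-fromℚᵘ (ℚᵘ.mkℚᵘ b 0)) ⟨
    ℚ.toℚᵘ (ι a) ℚᵘ.+ ℚ.toℚᵘ (ι b)        ≈⟨ ℚₚ.toℚᵘ-homo-+ (ι a) (ι b) ⟨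
    ℚ.toℚᵘ (ι a + ι b)                    ∎)
    where
    open ℚᵘₚ.≃-Reasoning
    eq : ∀ a b → (a ℤ.+ b) ℤ.* (+ 1 ℤ.* + 1) ≡ (a ℤ.* + 1 ℤ.+ b ℤ.* + 1) ℤ.* + 1
    eq = ℤSolver.solve-∀

  ι-homo-* : ∀ a b → ι (a ℤ.* b) ≡ ι a * ι b
  ι-homo-* a b = ℚₚ.toℚᵘ-injective (begin
    ℚ.toℚᵘ (ι (a ℤ.* b))                  ≈⟨ ℚₚ.toℚᵘ-fromℚᵘ (ℚᵘ.mkℚᵘ (a ℤ.* b) 0) ⟩
    ℚᵘ.mkℚᵘ a 0 ℚᵘ.* ℚᵘ.mkℚᵘ b 0          ≈⟨ ℚᵘₚ.*-cong (ℚₚ.toℚᵘ-fromℚᵘ (ℚᵘ.mkℚᵘ a 0)) (ℚₚ.toℚᵘ-fromℚᵘ (ℚᵘ.mkℚᵘ b 0)) ⟨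
    ℚ.toℚᵘ (ι a) ℚᵘ.* ℚ.toℚᵘ (ι b)        ≈⟨ ℚₚ.toℚᵘ-homo-* (ι a) (ι b) ⟨
    ℚ.toℚᵘ (ι a * ι b)                    ∎)
    where open ℚᵘₚ.≃-Reasoning

  ι-homo‿- : ∀ a → ι (ℤ.- a) ≡ - ι a
  ι-homo‿- (+ zero)  = refl
  ι-homo‿- (+ suc n) = refl
  ι-homo‿- -[1+ n ]  = neg-involutive (ℚ.normalize (suc n) 1)
    where
    neg-involutive : ∀ x → x ≡ - (- x)
    neg-involutive = solve-∀ ℚ-ring

  ι-cancel-≤ : ∀ {a b} → ι a ℚ.≤ ι b → a ℤ.≤ b
  ι-cancel-≤ {a} {b} ιa≤ιb with ℚᵘₚ.≤-respˡ-≃ (ℚₚ.toℚᵘ-fromℚᵘ (ℚᵘ.mkℚᵘ a 0)) (ℚᵘₚ.≤-respʳ-≃ (ℚₚ.toℚᵘ-fromℚᵘ (ℚᵘ.mkℚᵘ b 0)) (ℚₚ.toℚᵘ-mono-≤ ιa≤ιb))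
  ... | ℚᵘ.*≤* a1≤b1 = ℤₚ.*-cancelʳ-≤-pos a b (+ 1) a1≤b1

  ι-mono-≤ : ∀ {a b} → a ℤ.≤ b → ι a ℚ.≤ ι b
  ι-mono-≤ {a} {b} a≤b = ℚₚ.toℚᵘ-cancel-≤ (ℚᵘₚ.≤-respˡ-≃ (ℚᵘₚ.≃-sym (ℚₚ.toℚᵘ-fromℚᵘ (ℚᵘ.mkℚᵘ a 0))) (ℚᵘₚ.≤-respʳ-≃ (ℚᵘₚ.≃-sym (ℚₚ.toℚᵘ-fromℚᵘ (ℚᵘ.mkℚᵘ b 0))) (ℚᵘ.*≤* (ℤₚ.*-monoʳ-≤-nonNeg (+ 1) a≤b))))

  ι-pos : ∀ n → ℚ.Positive (ι (+ suc n))
  ι-pos n = ℚₚ.normalize-pos (suc n) 1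

  ι-neg : ∀ n → ℚ.Negative (ι -[1+ n ])
  ι-neg n = ℚₚ.neg-pos {ℚ.normalize (suc n) 1} (ℚₚ.normalize-pos (suc n) 1)

  Σℚ≡sum : ∀ {n} (f : Fin n → ℚ) → Σℚ f ≡ sum f
  Σℚ≡sum {zero}  f = refl
  Σℚ≡sum {suc n} f = cong (_+_ (f fz)) (Σℚ≡sum (f ∘ fs))

  Σℚ-cong : ∀ {n} {f g : Fin n → ℚ} → (∀ i → f i ≡ g i) → Σℚ f ≡ Σℚ g
  Σℚ-cong {zero}  f≗g = refl
  Σℚ-cong {suc n} f≗g = cong₂ _+_ (f≗g fz) (Σℚ-cong (f≗g ∘ fs))

  Σℚ-zero : ∀ n → Σℚ {n} (λ _ → 0ℚ) ≡ 0ℚ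
  Σℚ-zero zero    = refl
  Σℚ-zero (suc n) = trans (ℚₚ.+-identityˡ _) (Σℚ-zero n)

  Σℚ-distrib-+ : ∀ {n} (f g : Fin n → ℚ) → Σℚ (λ i → f i + g i) ≡ Σℚ f + Σℚ g
  Σℚ-distrib-+ f g = trans (Σℚ≡sum (λ i → f i + g i)) (trans (∑-distrib-+ f g) (sym (cong₂ _+_ (Σℚ≡sum f) (Σℚ≡sum g))))

  *-distribˡ-Σℚ : ∀ {n} x (f : Fin n → ℚ) → x * Σℚ f ≡ Σℚ (λ i → x * f i)
  *-distribˡ-Σℚ x f = trans (cong (x *_) (Σℚ≡sum f)) (trans (*-distribˡ-sum x f) (sym (Σℚ≡sum (λ i → x * f i))))

  *-distribʳ-Σℚ : ∀ {n} x (f : Fin n → ℚ) → Σℚ f * x ≡ Σℚ (λ i → f i * x)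
  *-distribʳ-Σℚ x f = trans (ℚₚ.*-comm _ x) (trans (*-distribˡ-Σℚ x f) (Σℚ-cong (λ i → ℚₚ.*-comm x (f i))))

  Σℚ-comm : ∀ {m n} (f : Fin m → Fin n → ℚ) → Σℚ (λ i → Σℚ (f i)) ≡ Σℚ (λ j → Σℚ (λ i → f i j))
  Σℚ-comm f = trans (double f) (trans (∑-comm f) (sym (double (λ j i → f i j))))
    where
    double : ∀ {m n} (g : Fin m → Fin n → ℚ) → Σℚ (λ i → Σℚ (g i)) ≡ sum (λ i → sum (g i))
    double g = trans (Σℚ-cong (λ i → Σℚ≡sum (g i))) (Σℚ≡sum (λ i → sum (g i)))

  Σℚ-remove : ∀ {n} (p : Fin (suc n)) f → Σℚ f ≡ f p + Σℚ (f ∘ punchIn p)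
  Σℚ-remove p f = trans (Σℚ≡sum f) (trans (sum-remove {i = p} f) (cong (_+_ (f p)) (sym (Σℚ≡sum (f ∘ punchIn p)))))

  Σℚ-nonNeg : ∀ {n} (f : Fin n → ℚ) → (∀ i → 0ℚ ℚ.≤ f i) → 0ℚ ℚ.≤ Σℚ f
  Σℚ-nonNeg {zero}  f 0≤f = ℚₚ.≤-refl
  Σℚ-nonNeg {suc n} f 0≤f = ℚₚ.+-mono-≤ (0≤f fz) (Σℚ-nonNeg (f ∘ fs) (0≤f ∘ fs))

  *-nonNeg : ∀ {p q} → 0ℚ ℚ.≤ p → 0ℚ ℚ.≤ q → 0ℚ ℚ.≤ p * q
  *-nonNeg {p} {q} 0≤p 0≤q = ℚₚ.nonNegative⁻¹ (p * q) {{ℚₚ.nonNeg*nonNeg⇒nonNeg p {{ℚ.nonNegative 0≤p}} q {{ℚ.nonNegative 0≤q}}}}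

  -- Gaussian elimination: solve the first equation for an unknown with nonzero coefficient.
  nontrivial-kernel : ∀ k (a : Fin k → Fin (suc k) → ℚ) →
    Σ (Fin (suc k) → ℚ) λ μ → (∃ λ i → μ i ≢ 0ℚ) × (∀ r → Σℚ (λ i → μ i * a r i) ≡ 0ℚ)
  nontrivial-kernel zero a = (λ _ → 1ℚ) , (fz , λ ()) , λ ()
  nontrivial-kernel (suc k) a with Finₚ.any? (λ i → ¬? (a fz i ℚ.≟ 0ℚ))
  -- The first equation is void. Dropping it and setting unknown 0 to zero keeps one unknown more
  -- than equations.
  ... | no all0 with nontrivial-kernel k (λ r i → a (fs r) (fs i))
  ... | μ , (i , μi≢0) , ker = μ′ , (fs i , μi≢0) , ker′
    where
    μ′ : Fin (suc (suc k)) → ℚ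
    μ′ fz = 0ℚ
    μ′ (fs i) = μ i
    a0≡0 : ∀ i → a fz i ≡ 0ℚ
    a0≡0 i with a fz i ℚ.≟ 0ℚ
    ... | yes eq = eq
    ... | no neq = contradiction (i , neq) all0
    ker′ : ∀ r → Σℚ (λ i → μ′ i * a r i) ≡ 0ℚ
    ker′ fz = trans (Σℚ-cong (λ i → trans (cong (μ′ i *_) (a0≡0 i)) (ℚₚ.*-zeroʳ (μ′ i)))) (Σℚ-zero (suc (suc k)))
    ker′ (fs r) = trans (cong₂ _+_ (ℚₚ.*-zeroˡ (a (fs r) fz)) (ker r)) (ℚₚ.+-identityˡ 0ℚ)
  nontrivial-kernel (suc k) a | yes (p , ap≢0) = μ′ , (punchIn p i , μ′i≢0) , ker′
    where
    instance
      pivot≢0 : ℚ.NonZero (a fz p)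
      pivot≢0 = ℚ.≢-nonZero ap≢0
    rec = nontrivial-kernel k (λ r i → a (fs r) (punchIn p i) - a fz (punchIn p i) * ℚ.1/ a fz p * a (fs r) p)
    μ = proj₁ rec
    i = proj₁ (proj₁ (proj₂ rec))
    s = Σℚ (λ i → μ i * a fz (punchIn p i))
    μp = - (s * ℚ.1/ a fz p)
    μ′ = insertAt μ p μp
    μ′i≢0 : μ′ (punchIn p i) ≢ 0ℚ
    μ′i≢0 eq = proj₂ (proj₁ (proj₂ rec)) (trans (sym (VFₚ.insertAt-punchIn μ p μp i)) eq)
    expand : ∀ r → Σℚ (λ i → μ′ i * a r i) ≡ μp * a r p + Σℚ (λ i → μ i * a r (punchIn p i))
    expand r = trans (Σℚ-remove p (λ i → μ′ i * a r i)) (cong₂ _+_ (cong (_* a r p) (VFₚ.insertAt-lookup μ p μp))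
      (Σℚ-cong (λ i → cong (_* a r (punchIn p i)) (VFₚ.insertAt-punchIn μ p μp i))))
    cancel : ∀ s x y → - (s * y) * x + s ≡ s * (1ℚ - y * x)
    cancel = solve-∀ ℚ-ring
    rearr : ∀ s x y t → - (s * y) * x + t ≡ t + (- (y * x)) * s
    rearr = solve-∀ ℚ-ring
    distr : ∀ m b c y z → m * b + (- (y * z)) * (m * c) ≡ m * (b - c * y * z)
    distr = solve-∀ ℚ-ring
    ker′ : ∀ r → Σℚ (λ i → μ′ i * a r i) ≡ 0ℚ
    ker′ fz = trans (expand fz) (trans (cancel s (a fz p) (ℚ.1/ a fz p))
      (trans (cong (λ z → s * (1ℚ - z)) (ℚₚ.*-inverseˡ (a fz p))) (ℚₚ.*-zeroʳ s)))
    ker′ (fs r) = begin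
      Σℚ (λ i → μ′ i * a (fs r) i)   ≡⟨ expand (fs r) ⟩
      μp * a (fs r) p + Σℚ f         ≡⟨ rearr s (a (fs r) p) (ℚ.1/ a fz p) (Σℚ f) ⟩
      Σℚ f + c * s                   ≡⟨ cong (_+_ (Σℚ f)) (*-distribˡ-Σℚ c g) ⟩
      Σℚ f + Σℚ (λ i → c * g i)      ≡⟨ Σℚ-distrib-+ f (λ i → c * g i) ⟨
      Σℚ (λ i → f i + c * g i)       ≡⟨ Σℚ-cong (λ i → distr (μ i) (a (fs r) (punchIn p i)) (a fz (punchIn p i)) (ℚ.1/ a fz p) (a (fs r) p)) ⟩
      _                              ≡⟨ proj₂ (proj₂ rec) r ⟩
      0ℚ                             ∎
      where
      open ≡-Reasoning
      f g : Fin (suc k) → ℚ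
      f i = μ i * a (fs r) (punchIn p i)
      g i = μ i * a fz (punchIn p i)
      c = - (ℚ.1/ a fz p * a (fs r) p)

-- An affine dependence among N + 2 points solves N + 1 homogeneous equations: one for each
-- coordinate, and a row of ones for the vanishing of the sum.
¬affIndep : ∀ {N} (w : Fin (suc (suc N)) → Point N) → ¬ AffIndep w
¬affIndep {N} w indep with nontrivial-kernel (suc N) rows
  where
  rows : Fin (suc N) → Fin (suc (suc N)) → ℚ
  rows fz i = 1ℚ
  rows (fs j) i = ι (lookup (w i) j)
... | μ , (i , μi≢0) , ker = μi≢0 (indep μ (trans (Σℚ-cong (λ i → sym (ℚₚ.*-identityʳ (μ i)))) (ker fz)) (ker ∘ fs) i)

-- Products of polytopes

module _ where
  open import Data.Rational using (_+_; _*_; -_; _-_)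

  Σℚ-++ : ∀ m {n} (f : Fin (m ℕ.+ n) → ℚ) → Σℚ f ≡ Σℚ (λ i → f (i ↑ˡ n)) + Σℚ (λ j → f (m ↑ʳ j))
  Σℚ-++ zero    f = sym (ℚₚ.+-identityˡ (Σℚ f))
  Σℚ-++ (suc m) f = trans (cong (_+_ (f fz)) (Σℚ-++ m (f ∘ fs))) (sym (ℚₚ.+-assoc (f fz) _ _))

  Σℚ-combine : ∀ m {n} (f : Fin (m ℕ.* n) → ℚ) → Σℚ f ≡ Σℚ (λ i → Σℚ (λ j → f (combine {m} i j)))
  Σℚ-combine zero        f = refl
  Σℚ-combine (suc m) {n} f = trans (Σℚ-++ n f) (cong (_+_ (Σℚ (λ j → f (j ↑ˡ (m ℕ.* n))))) (Σℚ-combine m (λ k → f (n ↑ʳ k))))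

  ↑-elim : ∀ m {n} (P : Fin (m ℕ.+ n) → Set) → (∀ i → P (i ↑ˡ n)) → (∀ j → P (m ↑ʳ j)) → ∀ k → P k
  ↑-elim zero    P l r k      = r k
  ↑-elim (suc m) P l r fz     = l fz
  ↑-elim (suc m) P l r (fs k) = ↑-elim m (P ∘ fs) (l ∘ fs) r k

  length-cartesianProductWith : ∀ {A B C : Set} {f : A → B → C} xs ys → length (cartesianProductWith f xs ys) ≡ length xs ℕ.* length ys
  length-cartesianProductWith         []       ys = refl
  length-cartesianProductWith {f = f} (x ∷ xs) ys = trans (Listₚ.length-++ (List.map (f x) ys))
    (cong₂ ℕ._+_ (Listₚ.length-map (f x) ys) (length-cartesianProductWith xs ys))

  infixr 5 _⊗_

  -- The count `m` is arranged so that `suc (m (P ⊗ Q))` computes to `suc (m P) * suc (m Q)`, the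
  -- index type of `combine` and `remQuot`.
  _⊗_ : ∀ {N N′} → IntegralPolytope N → IntegralPolytope N′ → IntegralPolytope (N ℕ.+ N′)
  (P ⊗ Q) .m     = m Q ℕ.+ m P ℕ.* suc (m Q)
  (P ⊗ Q) .gen k = gen P (proj₁ (remQuot {suc (m P)} (suc (m Q)) k)) ++ gen Q (proj₂ (remQuot {suc (m P)} (suc (m Q)) k))

  module _ {N N′} (P : IntegralPolytope N) (Q : IntegralPolytope N′) where

    pair : Fin (suc (m P)) → Fin (suc (m Q)) → Fin (suc (m P) ℕ.* suc (m Q))
    pair = combine

    gen-pair : ∀ i j → gen (P ⊗ Q) (pair i j) ≡ gen P i ++ gen Q j
    gen-pair i j = cong (λ (i , j) → gen P i ++ gen Q j) (Finₚ.remQuot-combine {suc (m P)} i j)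

    lookup-gen-ˡ : ∀ i j k → lookup (gen (P ⊗ Q) (pair i j)) (k ↑ˡ N′) ≡ lookup (gen P i) k
    lookup-gen-ˡ i j k = trans (cong (λ v → lookup v (k ↑ˡ N′)) (gen-pair i j)) (Vecₚ.lookup-++ˡ (gen P i) (gen Q j) k)

    lookup-gen-ʳ : ∀ i j k → lookup (gen (P ⊗ Q) (pair i j)) (N ↑ʳ k) ≡ lookup (gen Q j) k
    lookup-gen-ʳ i j k = trans (cong (λ v → lookup v (N ↑ʳ k)) (gen-pair i j)) (Vecₚ.lookup-++ʳ (gen P i) (gen Q j) k)

    module _ (c : Fin (suc (m P) ℕ.* suc (m Q)) → ℚ) where

      -- Weights on pairs of generators are treated as a joint distribution; each factor of the
      -- product sees only its own marginal.
      marginalˡ : Fin (suc (m P)) → ℚ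
      marginalˡ i = Σℚ (λ j → c (pair i j))

      marginalʳ : Fin (suc (m Q)) → ℚ
      marginalʳ j = Σℚ (λ i → c (pair i j))

      Σℚ-marginalˡ : Σℚ marginalˡ ≡ Σℚ c
      Σℚ-marginalˡ = sym (Σℚ-combine (suc (m P)) c)

      Σℚ-marginalʳ : Σℚ marginalʳ ≡ Σℚ c
      Σℚ-marginalʳ = trans (sym (Σℚ-comm (λ i j → c (pair i j)))) Σℚ-marginalˡ

      -- A coordinate in the first block depends on the first index of a pair alone, so the inner
      -- sum over the second index collapses to the marginal.
      barycentre-ˡ : ∀ k → Σℚ (λ l → c l * ι (lookup (gen (P ⊗ Q) l) (k ↑ˡ N′))) ≡
                           Σℚ (λ i → marginalˡ i * ι (lookup (gen P i) k))
      barycentre-ˡ k = trans (Σℚ-combine (suc (m P)) (λ l → c l * ι (lookup (gen (P ⊗ Q) l) (k ↑ˡ N′)))) (Σℚ-cong (λ i →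
        trans (Σℚ-cong (λ j → cong (λ z → c (pair i j) * ι z) (lookup-gen-ˡ i j k)))
              (sym (*-distribʳ-Σℚ (ι (lookup (gen P i) k)) (λ j → c (pair i j))))))

      barycentre-ʳ : ∀ k → Σℚ (λ l → c l * ι (lookup (gen (P ⊗ Q) l) (N ↑ʳ k))) ≡
                           Σℚ (λ j → marginalʳ j * ι (lookup (gen Q j) k))
      barycentre-ʳ k = trans (Σℚ-combine (suc (m P)) (λ l → c l * ι (lookup (gen (P ⊗ Q) l) (N ↑ʳ k))))
        (trans (Σℚ-cong (λ i → Σℚ-cong (λ j → cong (λ z → c (pair i j) * ι z) (lookup-gen-ʳ i j k))))
        (trans (Σℚ-comm (λ i j → c (pair i j) * ι (lookup (gen Q j) k)))
               (Σℚ-cong (λ j → sym (*-distribʳ-Σℚ (ι (lookup (gen Q j) k)) (λ i → c (pair i j)))))))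

    inDilate-⊗⁻ : ∀ {t} (x : Point N) {y : Point N′} → InDilate (P ⊗ Q) t (x ++ y) → InDilate P t x × InDilate Q t y
    inDilate-⊗⁻ {t} x {y} (c , c≥0 , Σc≡1 , eq) =
      (marginalˡ c , (λ i → Σℚ-nonNeg _ (λ j → c≥0 (pair i j))) , trans (Σℚ-marginalˡ c) Σc≡1 ,
        λ k → trans (cong ι (sym (Vecₚ.lookup-++ˡ x y k))) (trans (eq (k ↑ˡ N′)) (cong (_*_ (ι (+ t))) (barycentre-ˡ c k)))) ,
      (marginalʳ c , (λ j → Σℚ-nonNeg (λ i → c (pair i j)) (λ i → c≥0 (pair i j))) , trans (Σℚ-marginalʳ c) Σc≡1 ,
        λ k → trans (cong ι (sym (Vecₚ.lookup-++ʳ x y k))) (trans (eq (N ↑ʳ k)) (cong (_*_ (ι (+ t))) (barycentre-ʳ c k))))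

    -- The independent coupling `a i * b j` works: its marginals are `a` and `b` because both have
    -- total weight 1.
    inDilate-⊗⁺ : ∀ {t} {x : Point N} {y : Point N′} → InDilate P t x → InDilate Q t y → InDilate (P ⊗ Q) t (x ++ y)
    inDilate-⊗⁺ {t} {x} {y} (a , a≥0 , Σa≡1 , eqa) (b , b≥0 , Σb≡1 , eqb) = c , c≥0 , Σc≡1 , eq
      where
      ab : Fin (suc (m P)) × Fin (suc (m Q)) → ℚ
      ab (i , j) = a i * b j
      c : Fin (suc (m P) ℕ.* suc (m Q)) → ℚ
      c k = ab (remQuot {suc (m P)} (suc (m Q)) k)
      c-pair : ∀ i j → c (pair i j) ≡ a i * b j
      c-pair i j = cong ab (Finₚ.remQuot-combine {suc (m P)} i j)
      c≥0 : ∀ k → 0ℚ ℚ.≤ c k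
      c≥0 k = *-nonNeg (a≥0 _) (b≥0 _)
      c-ˡ : ∀ i → marginalˡ c i ≡ a i
      c-ˡ i = trans (Σℚ-cong (c-pair i)) (trans (sym (*-distribˡ-Σℚ (a i) b)) (trans (cong (_*_ (a i)) Σb≡1) (ℚₚ.*-identityʳ (a i))))
      c-ʳ : ∀ j → marginalʳ c j ≡ b j
      c-ʳ j = trans (Σℚ-cong (λ i → c-pair i j)) (trans (sym (*-distribʳ-Σℚ (b j) a)) (trans (cong (λ z → z * b j) Σa≡1) (ℚₚ.*-identityˡ (b j))))
      Σc≡1 : Σℚ c ≡ 1ℚ
      Σc≡1 = trans (sym (Σℚ-marginalˡ c)) (trans (Σℚ-cong c-ˡ) Σa≡1)
      eq : ∀ k → ι (lookup (x ++ y) k) ≡ ι (+ t) * Σℚ (λ l → c l * ι (lookup (gen (P ⊗ Q) l) k))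
      eq = ↑-elim N _
        (λ k → trans (cong ι (Vecₚ.lookup-++ˡ x y k)) (trans (eqa k) (cong (_*_ (ι (+ t)))
          (sym (trans (barycentre-ˡ c k) (Σℚ-cong (λ i → cong (λ z → z * ι (lookup (gen P i) k)) (c-ˡ i))))))))
        (λ k → trans (cong ι (Vecₚ.lookup-++ʳ x y k)) (trans (eqb k) (cong (_*_ (ι (+ t)))
          (sym (trans (barycentre-ʳ c k) (Σℚ-cong (λ j → cong (λ z → z * ι (lookup (gen Q j) k)) (c-ʳ j))))))))

    latticeCount-⊗ : ∀ {t n n′} → LatticeCount P t n → LatticeCount Q t n′ → LatticeCount (P ⊗ Q) t (n ℕ.* n′)
    latticeCount-⊗ {t} (L , uL , memL , refl) (L′ , uL′ , memL′ , refl) =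
      cartesianProductWith _++_ L L′ ,
      Uniqueₚ.cartesianProductWith⁺ _++_ (λ {w} {x} → Vecₚ.++-injective w x) uL uL′ ,
      (λ z → mk⇔ (to z) (from z)) ,
      length-cartesianProductWith L L′
      where
      to : ∀ z → z ∈ cartesianProductWith _++_ L L′ → InDilate (P ⊗ Q) t z
      to z z∈ with x , y , x∈ , y∈ , refl ← ∈ₚ.∈-cartesianProductWith⁻ _++_ L L′ z∈ =
        inDilate-⊗⁺ {t} {x} {y} (Equivalence.to (memL x) x∈) (Equivalence.to (memL′ y) y∈)
      from : ∀ z → InDilate (P ⊗ Q) t z → z ∈ cartesianProductWith _++_ L L′
      from z z∈ with x , y , refl ← Vec.splitAt N z =
        let x∈ , y∈ = inDilate-⊗⁻ {t} x {y} z∈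
        in ∈ₚ.∈-cartesianProductWith⁺ _++_ (Equivalence.from (memL x) x∈) (Equivalence.from (memL′ y) y∈)

  LinIndep : ∀ {N k} → (Fin k → Point N) → Set
  LinIndep {N} {k} w = ∀ (μ : Fin k → ℚ) → (∀ j → Σℚ (λ i → μ i * ι (lookup (w i) j)) ≡ 0ℚ) → ∀ i → μ i ≡ 0ℚ

  -- As generator 0 is the origin, linear independence suffices for affine independence.
  FullDimensional : ∀ {N} → IntegralPolytope N → Set
  FullDimensional {N} P =
    (∀ j → lookup (gen P fz) j ≡ + 0) × Σ (Fin N → Fin (suc (m P))) λ g → LinIndep (gen P ∘ g)

  -- The coordinate equations do not see the weight of the origin, so linear independence kills all
  -- other weights, and the vanishing of the total then kills this one. Maximality is `¬affIndep`,
  -- since the dimension is that of the ambient space.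
  fullDimensional⇒hasDim : ∀ {N} {P : IntegralPolytope N} → FullDimensional P → HasDim P N
  fullDimensional⇒hasDim {N} {P} (origin , g , indep) = (f , aff) , λ h → ¬affIndep (gen P ∘ h)
    where
    f : Fin (suc N) → Fin (suc (m P))
    f fz     = fz
    f (fs i) = g i
    aff : AffIndep (gen P ∘ f)
    aff μ Σμ≡0 eq = go
      where
      S : Fin N → ℚ
      S j = Σℚ (λ i → μ (fs i) * ι (lookup (gen P (g i)) j))
      rest : ∀ i → μ (fs i) ≡ 0ℚ
      rest = indep (μ ∘ fs) (λ j → trans (sym (trans (cong (λ z → μ fz * ι z + S j) (origin j))
        (trans (cong (λ z → z + S j) (ℚₚ.*-zeroʳ (μ fz))) (ℚₚ.+-identityˡ (S j))))) (eq j))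
      go : ∀ i → μ i ≡ 0ℚ
      go fz     = trans (sym (trans (cong (_+_ (μ fz)) (trans (Σℚ-cong rest) (Σℚ-zero N))) (ℚₚ.+-identityʳ (μ fz)))) Σμ≡0
      go (fs i) = rest i

  -- Pairing the chosen generators of one factor with the origin of the other gives the vectors
  -- `(v , 0)` and `(0 , v′)`. Their matrix is block diagonal, so each block is handled by the
  -- independence in its own factor.
  fullDimensional-⊗ : ∀ {N N′} {P : IntegralPolytope N} {Q : IntegralPolytope N′} →
    FullDimensional P → FullDimensional Q → FullDimensional (P ⊗ Q)
  fullDimensional-⊗ {N} {N′} {P} {Q} (oP , gP , iP) (oQ , gQ , iQ) =
    ↑-elim N _ (λ k → trans (lookup-gen-ˡ P Q fz fz k) (oP k)) (λ k → trans (lookup-gen-ʳ P Q fz fz k) (oQ k)) ,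
    g , indep
    where
    idxˡ : Fin N → Fin (suc (m P) ℕ.* suc (m Q))
    idxˡ i = pair P Q (gP i) fz
    idxʳ : Fin N′ → Fin (suc (m P) ℕ.* suc (m Q))
    idxʳ j = pair P Q fz (gQ j)
    g : Fin (N ℕ.+ N′) → Fin (suc (m P) ℕ.* suc (m Q))
    g k = [ idxˡ , idxʳ ]′ (splitAt N k)
    indep : LinIndep (gen (P ⊗ Q) ∘ g)
    indep μ eq = ↑-elim N _
      (iP (λ i → μ (i ↑ˡ N′)) (λ k → trans (sym (trans (split (k ↑ˡ N′)) (trans (cong₂ _+_
        (Σℚ-cong (λ i → cong (λ z → μ (i ↑ˡ N′) * ι z) (lookup-gen-ˡ P Q (gP i) fz k)))
        (trans (Σℚ-cong (λ j → trans (cong (λ z → μ (N ↑ʳ j) * ι z) (trans (lookup-gen-ˡ P Q fz (gQ j) k) (oP k))) (ℚₚ.*-zeroʳ (μ (N ↑ʳ j))))) (Σℚ-zero N′)))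
        (ℚₚ.+-identityʳ _)))) (eq (k ↑ˡ N′))))
      (iQ (λ j → μ (N ↑ʳ j)) (λ k → trans (sym (trans (split (N ↑ʳ k)) (trans (cong₂ _+_
        (trans (Σℚ-cong (λ i → trans (cong (λ z → μ (i ↑ˡ N′) * ι z) (trans (lookup-gen-ʳ P Q (gP i) fz k) (oQ k))) (ℚₚ.*-zeroʳ (μ (i ↑ˡ N′))))) (Σℚ-zero N))
        (Σℚ-cong (λ j → cong (λ z → μ (N ↑ʳ j) * ι z) (lookup-gen-ʳ P Q fz (gQ j) k))))
        (ℚₚ.+-identityˡ _)))) (eq (N ↑ʳ k))))
      where
      split : ∀ k → Σℚ (λ i → μ i * ι (lookup (gen (P ⊗ Q) (g i)) k)) ≡
        Σℚ (λ i → μ (i ↑ˡ N′) * ι (lookup (gen (P ⊗ Q) (idxˡ i)) k)) +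
        Σℚ (λ j → μ (N ↑ʳ j) * ι (lookup (gen (P ⊗ Q) (idxʳ j)) k))
      split k = trans (Σℚ-++ N (λ i → μ i * ι (lookup (gen (P ⊗ Q) (g i)) k))) (cong₂ _+_
        (Σℚ-cong (λ i → cong (λ s → μ (i ↑ˡ N′) * ι (lookup (gen (P ⊗ Q) ([ idxˡ , idxʳ ]′ s)) k)) (Finₚ.splitAt-↑ˡ N i N′)))
        (Σℚ-cong (λ j → cong (λ s → μ (N ↑ʳ j) * ι (lookup (gen (P ⊗ Q) ([ idxˡ , idxʳ ]′ s)) k)) (Finₚ.splitAt-↑ʳ N N′ j))))

-- Vectors of natural numbers with bounded sum

module _ where
  open import Data.Nat using (_+_; _*_)

  incHead : ∀ {d} → Vec ℕ (suc d) → Vec ℕ (suc d)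
  incHead (x ∷ a) = suc x ∷ a

  -- The recursion is Pascal's rule: a vector either starts with 0 or arises from one of smaller sum
  -- by raising its head. Hence there are no repetitions and the length is C(n + d, d).
  simplexPoints : ∀ d → ℕ → List (Vec ℕ d)
  simplexPoints zero    n       = [] ∷ []
  simplexPoints (suc d) zero    = List.map (0 ∷_) (simplexPoints d zero)
  simplexPoints (suc d) (suc n) =
    List.map (0 ∷_) (simplexPoints d (suc n)) List.++ List.map incHead (simplexPoints (suc d) n)

  ∈-simplexPoints⁺ : ∀ {d} n (a : Vec ℕ d) → Vec.sum a ≤ n → a ∈ simplexPoints d n
  ∈-simplexPoints⁺ n       []          _         = here refl
  ∈-simplexPoints⁺ zero    (zero  ∷ a) Σa≤n       = ∈ₚ.∈-map⁺ (0 ∷_) (∈-simplexPoints⁺ zero a Σa≤n)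
  ∈-simplexPoints⁺ (suc n) (zero  ∷ a) Σa≤n       = ∈ₚ.∈-++⁺ˡ (∈ₚ.∈-map⁺ (0 ∷_) (∈-simplexPoints⁺ (suc n) a Σa≤n))
  ∈-simplexPoints⁺ (suc n) (suc x ∷ a) (s≤s Σa≤n) = ∈ₚ.∈-++⁺ʳ (List.map (0 ∷_) (simplexPoints _ (suc n))) (∈ₚ.∈-map⁺ incHead (∈-simplexPoints⁺ n (x ∷ a) Σa≤n))

  ∈-simplexPoints⁻ : ∀ d n {a : Vec ℕ d} → a ∈ simplexPoints d n → Vec.sum a ≤ n
  ∈-simplexPoints⁻ zero    n       (here refl) = z≤n
  ∈-simplexPoints⁻ (suc d) zero    a∈ with _ , b∈ , refl ← ∈ₚ.∈-map⁻ (0 ∷_) a∈ = ∈-simplexPoints⁻ d zero b∈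
  ∈-simplexPoints⁻ (suc d) (suc n) a∈ with ∈ₚ.∈-++⁻ (List.map (0 ∷_) (simplexPoints d (suc n))) a∈
  ... | inj₁ a∈ˡ with _ , b∈ , refl ← ∈ₚ.∈-map⁻ (0 ∷_) a∈ˡ = ∈-simplexPoints⁻ d (suc n) b∈
  ... | inj₂ a∈ʳ with (x ∷ b) , b∈ , refl ← ∈ₚ.∈-map⁻ incHead a∈ʳ = s≤s (∈-simplexPoints⁻ (suc d) n b∈)

  simplexPoints-unique : ∀ d n → Unique (simplexPoints d n)
  simplexPoints-unique zero    n       = [] ∷ []
  simplexPoints-unique (suc d) zero    = Uniqueₚ.map⁺ Vecₚ.∷-injectiveʳ (simplexPoints-unique d zero)
  simplexPoints-unique (suc d) (suc n) = Uniqueₚ.++⁺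
    (Uniqueₚ.map⁺ Vecₚ.∷-injectiveʳ (simplexPoints-unique d (suc n)))
    (Uniqueₚ.map⁺ incHead-injective (simplexPoints-unique (suc d) n))
    λ (a∈ˡ , a∈ʳ) → disjoint a∈ˡ a∈ʳ
    where
    incHead-injective : ∀ {a b : Vec ℕ (suc d)} → incHead a ≡ incHead b → a ≡ b
    incHead-injective {x ∷ a} {.x ∷ .a} refl = refl
    disjoint : ∀ {a xs ys} → a ∈ List.map (0 ∷_) xs → ¬ a ∈ List.map incHead ys
    disjoint a∈ˡ a∈ʳ with ∈ₚ.∈-map⁻ (0 ∷_) a∈ˡ | ∈ₚ.∈-map⁻ incHead a∈ʳ
    ... | _ , _ , refl | (_ ∷ _) , _ , ()

  -- The vectors a with l + Σ a ≤ s.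
  shiftedPoints : ∀ d → ℕ → ℕ → List (Vec ℕ d)
  shiftedPoints d zero    s       = simplexPoints d s
  shiftedPoints d (suc l) zero    = []
  shiftedPoints d (suc l) (suc s) = shiftedPoints d l s

  ∈-shiftedPoints⁺ : ∀ {d} l s (a : Vec ℕ d) → l + Vec.sum a ≤ s → a ∈ shiftedPoints d l s
  ∈-shiftedPoints⁺ zero    s       a le       = ∈-simplexPoints⁺ s a le
  ∈-shiftedPoints⁺ (suc l) (suc s) a (s≤s le) = ∈-shiftedPoints⁺ l s a le

  ∈-shiftedPoints⁻ : ∀ {d} l s {a : Vec ℕ d} → a ∈ shiftedPoints d l s → l + Vec.sum a ≤ s
  ∈-shiftedPoints⁻ zero    s       a∈ = ∈-simplexPoints⁻ _ s a∈
  ∈-shiftedPoints⁻ (suc l) (suc s) a∈ = s≤s (∈-shiftedPoints⁻ l s a∈)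

  shiftedPoints-unique : ∀ d l s → Unique (shiftedPoints d l s)
  shiftedPoints-unique d zero    s       = simplexPoints-unique d s
  shiftedPoints-unique d (suc l) zero    = []
  shiftedPoints-unique d (suc l) (suc s) = shiftedPoints-unique d l s

-- Rising factorials and the number of vectors with bounded sum

module _ where
  open import Data.Integer using (_+_; _*_; -_; _-_)

  -- (z + 1) (z + 2) ⋯ (z + d)
  rising : ℕ → ℤ → ℤ
  rising zero    z = + 1
  rising (suc d) z = rising d z * (z + + suc d)

  -- Splitting off the first factor instead of the last gives both summands of Pascal's rule the
  -- common factor `rising d (+ suc n)`.
  rising-suc : ∀ d z → rising (suc d) z ≡ (z + + 1) * rising d (z + + 1)
  rising-suc zero    z = ℤₚ.*-comm (+ 1) (z + + 1)
  rising-suc (suc d) z = trans (cong (_* (z + + suc (suc d))) (rising-suc d z)) (eq z (rising d (z + + 1)) (+ suc d))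
    where
    eq : ∀ z r e → ((z + + 1) * r) * (z + (+ 1 + e)) ≡ (z + + 1) * (r * ((z + + 1) + e))
    eq = ℤSolver.solve-∀

  -- The roots of `rising d` are -1, ..., -d.
  rising-root : ∀ d l → l < d → rising d -[1+ l ] ≡ + 0
  rising-root (suc d) l (s≤s l≤d) with ℕₚ.m≤n⇒m<n∨m≡n l≤d
  ... | inj₁ l<d  = cong (_* (-[1+ l ] + + suc d)) (rising-root d l l<d)
  ... | inj₂ refl = trans (cong (rising d -[1+ l ] *_) (ℤₚ.+-inverseˡ (+ suc l))) (ℤₚ.*-zeroʳ (rising d -[1+ l ]))

  -- This is the value C(n + d, d), with the factorial cleared so that no division occurs.
  length-simplexPoints : ∀ d n → + (d !) * + length (simplexPoints d n) ≡ rising d (+ n)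
  length-simplexPoints zero    n    = refl
  length-simplexPoints (suc d) zero = begin
    + (suc d !) * + length (List.map (0 ∷_) (simplexPoints d 0)) ≡⟨ cong₂ (λ f l → f * + l) (ℤₚ.pos-* (suc d) (d !)) (Listₚ.length-map (0 ∷_) (simplexPoints d 0)) ⟩
    + suc d * + (d !) * + length (simplexPoints d 0)             ≡⟨ ℤₚ.*-assoc (+ suc d) (+ (d !)) _ ⟩
    + suc d * (+ (d !) * + length (simplexPoints d 0))           ≡⟨ cong (+ suc d *_) (length-simplexPoints d 0) ⟩
    + suc d * rising d (+ 0)                                     ≡⟨ ℤₚ.*-comm (+ suc d) _ ⟩
    rising (suc d) (+ 0)                                         ∎
    where open ≡-Reasoning
  length-simplexPoints (suc d) (suc n) = begin
    + (suc d !) * + length (simplexPoints (suc d) (suc n))  ≡⟨ cong (λ l → + (suc d !) * + l) len ⟩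
    + (suc d !) * (+ L₁ + + L₂)                             ≡⟨ ℤₚ.*-distribˡ-+ (+ (suc d !)) (+ L₁) (+ L₂) ⟩
    + (suc d !) * + L₁ + + (suc d !) * + L₂                 ≡⟨ cong₂ _+_ eq₁ (trans (length-simplexPoints (suc d) n) (rising-suc d (+ n))) ⟩
    + suc d * rising d (+ suc n) + (+ n + + 1) * rising d (+ n + + 1) ≡⟨ cong (λ k → + suc d * rising d (+ suc n) + + k * rising d (+ k)) (ℕₚ.+-comm n 1) ⟩
    + suc d * rising d (+ suc n) + + suc n * rising d (+ suc n) ≡⟨ eq (+ suc d) (rising d (+ suc n)) (+ suc n) ⟩
    rising (suc d) (+ suc n)                                ∎
    where
    open ≡-Reasoning
    L₁ = length (simplexPoints d (suc n))
    L₂ = length (simplexPoints (suc d) n)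
    len : length (simplexPoints (suc d) (suc n)) ≡ L₁ ℕ.+ L₂
    len = trans (Listₚ.length-++ (List.map (0 ∷_) (simplexPoints d (suc n))))
      (cong₂ ℕ._+_ (Listₚ.length-map (0 ∷_) (simplexPoints d (suc n))) (Listₚ.length-map incHead (simplexPoints (suc d) n)))
    eq₁ : + (suc d !) * + L₁ ≡ + suc d * rising d (+ suc n)
    eq₁ = trans (cong (_* + L₁) (ℤₚ.pos-* (suc d) (d !)))
      (trans (ℤₚ.*-assoc (+ suc d) (+ (d !)) (+ L₁)) (cong (+ suc d *_) (length-simplexPoints d (suc n))))
    eq : ∀ e r n → e * r + n * r ≡ r * (n + e)
    eq = ℤSolver.solve-∀

  -- For s < l the product on the right vanishes, as l ≤ d.
  length-shiftedPoints : ∀ d l s → l ≤ d → + (d !) * + length (shiftedPoints d l s) ≡ rising d (+ s - + l)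
  length-shiftedPoints d zero    s       _   = trans (length-simplexPoints d s) (cong (rising d) (sym (ℤₚ.+-identityʳ (+ s))))
  length-shiftedPoints d (suc l) zero    l<d = trans (ℤₚ.*-zeroʳ (+ (d !))) (sym (rising-root d l l<d))
  length-shiftedPoints d (suc l) (suc s) l<d = trans (length-shiftedPoints d l s (ℕₚ.<⇒≤ l<d))
    (cong (rising d) (eq (+ s) (+ l)))
    where
    eq : ∀ s l → s - l ≡ (+ 1 + s) - (+ 1 + l)
    eq = ℤSolver.solve-∀

-- Lattice points of cyclic simplices

module _ where
  open import Data.Rational using (_+_; _*_; -_; _-_)

  *-cancel-zero : ∀ p q .{{_ : ℚ.Positive q}} → p * q ≡ 0ℚ → p ≡ 0ℚ
  *-cancel-zero p q pq≡0 = begin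
    p                 ≡⟨ ℚₚ.*-identityʳ p ⟨
    p * 1ℚ            ≡⟨ cong (_*_ p) (ℚₚ.*-inverseʳ q) ⟨
    p * (q * ℚ.1/ q)  ≡⟨ ℚₚ.*-assoc p q (ℚ.1/ q) ⟨
    p * q * ℚ.1/ q    ≡⟨ cong (λ z → z * ℚ.1/ q) pq≡0 ⟩
    0ℚ * ℚ.1/ q       ≡⟨ ℚₚ.*-zeroˡ (ℚ.1/ q) ⟩
    0ℚ                ∎
    where
    open ≡-Reasoning
    instance
      q≢0 : ℚ.NonZero q
      q≢0 = ℚₚ.pos⇒nonZero q

  δ : ∀ {d} → ℤ → Fin d → Fin d → ℤ
  δ n fz     fz     = n
  δ n fz     (fs k) = + 0
  δ n (fs i) fz     = + 0
  δ n (fs i) (fs k) = δ n i k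

  Σℚ-δ : ∀ {d} n (c : Fin d → ℚ) k → Σℚ (λ i → c i * ι (δ n i k)) ≡ c k * ι n
  Σℚ-δ {suc d} n c fz     = trans (cong (_+_ (c fz * ι n)) (trans (Σℚ-cong (λ i → ℚₚ.*-zeroʳ (c (fs i)))) (Σℚ-zero d))) (ℚₚ.+-identityʳ (c fz * ι n))
  Σℚ-δ n c (fs k) = trans (cong₂ _+_ (ℚₚ.*-zeroʳ (c fz)) (Σℚ-δ n (c ∘ fs) k)) (ℚₚ.+-identityˡ (c (fs k) * ι n))

  Σℤ : ∀ {d} → (Fin d → ℤ) → ℤ
  Σℤ {zero}  f = + 0
  Σℤ {suc d} f = f fz ℤ.+ Σℤ (f ∘ fs)

  ι-Σℤ : ∀ {d} (f : Fin d → ℤ) → ι (Σℤ f) ≡ Σℚ (ι ∘ f)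
  ι-Σℤ {zero}  f = refl
  ι-Σℤ {suc d} f = trans (ι-homo-+ (f fz) (Σℤ (f ∘ fs))) (cong (_+_ (ι (f fz))) (ι-Σℤ (f ∘ fs)))

-- The simplex with vertices 0, n (M , - w) and n e_i for i ≥ 2, where n = suc n′ and M = suc M′.
record Simplex : Set where
  constructor Δ
  field
    n′ M′ : ℕ
    {d}   : ℕ
    w     : Vec ℕ d

  n M : ℕ
  n = suc n′
  M = suc M′

-- Barycentric coordinates of the simplex, and its dilates as integer inequalities

module _ (S : Simplex) where
  open Simplex S

  vertex : Fin (suc (suc d)) → Point (suc d)
  vertex fz          = Vec.replicate (suc d) (+ 0)
  vertex (fs fz)     = + (n ℕ.* M) ∷ Vec.map (λ v → ℤ.- + (n ℕ.* v)) w
  vertex (fs (fs i)) = + 0 ∷ Vec.tabulate (δ (+ n) i)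

  polytope : IntegralPolytope (suc d)
  polytope .IntegralPolytope.m   = suc d
  polytope .IntegralPolytope.gen = vertex

  module _ where
    open import Data.Rational using (_+_; _*_; -_; _-_)

    private
      N′ = ι (+ n)
      Mℚ = ι (+ M)

      W : Fin d → ℚ
      W k = ι (+ lookup w k)

      NM≡ : ι (+ (n ℕ.* M)) ≡ N′ * Mℚ
      NM≡ = trans (cong ι (ℤₚ.pos-* n M)) (ι-homo-* (+ n) (+ M))

    combination-head : ∀ (μ : Fin (suc d) → ℚ) → Σℚ (λ i → μ i * ι (lookup (vertex (fs i)) fz)) ≡ μ fz * (N′ * Mℚ)
    combination-head μ = trans (cong₂ _+_ (cong (_*_ (μ fz)) NM≡)
      (trans (Σℚ-cong (λ i → ℚₚ.*-zeroʳ (μ (fs i)))) (Σℚ-zero d))) (ℚₚ.+-identityʳ (μ fz * (N′ * Mℚ)))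

    combination-tail : ∀ (μ : Fin (suc d) → ℚ) k →
      Σℚ (λ i → μ i * ι (lookup (vertex (fs i)) (fs k))) ≡ μ fz * (- (N′ * W k)) + μ (fs k) * N′
    combination-tail μ k = cong₂ _+_
      (cong (_*_ (μ fz)) (trans (cong ι (Vecₚ.lookup-map k (λ v → ℤ.- + (n ℕ.* v)) w))
        (trans (ι-homo‿- (+ (n ℕ.* lookup w k))) (cong -_ (trans (cong ι (ℤₚ.pos-* n (lookup w k))) (ι-homo-* (+ n) (+ lookup w k)))))))
      (trans (Σℚ-cong (λ i → cong (λ z → μ (fs i) * ι z) (Vecₚ.lookup∘tabulate (δ (+ n) i) k))) (Σℚ-δ (+ n) (μ ∘ fs) k))

    -- The system is triangular: only the vertex `n (M , - w)` has a nonzero first coordinate, and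
    -- once its weight vanishes, each further coordinate involves a single `n e_k`.
    fullDimensional : FullDimensional polytope
    fullDimensional = (λ j → Vecₚ.lookup-replicate j (+ 0)) , fs , indep
      where
      instance
        posN : ℚ.Positive N′
        posN = ι-pos n′
        posM : ℚ.Positive Mℚ
        posM = ι-pos M′
        posNM : ℚ.Positive (N′ * Mℚ)
        posNM = ℚₚ.pos*pos⇒pos N′ Mℚ
      indep : LinIndep (vertex ∘ fs)
      indep μ eq = go
        where
        μ₀≡0 : μ fz ≡ 0ℚ
        μ₀≡0 = *-cancel-zero (μ fz) (N′ * Mℚ) (trans (sym (combination-head μ)) (eq fz))
        go : ∀ i → μ i ≡ 0ℚ
        go fz     = μ₀≡0
        go (fs k) = *-cancel-zero (μ (fs k)) N′ (trans (sym (trans (combination-tail μ k)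
          (trans (cong (λ z → z + μ (fs k) * N′) (trans (cong (λ z → z * (- (N′ * W k))) μ₀≡0) (ℚₚ.*-zeroˡ (- (N′ * W k)))))
            (ℚₚ.+-identityˡ (μ (fs k) * N′))))) (eq (fs k)))

    -- n M times the coefficient of the vertex n e_k in the expansion of y ∷ x.
    numerator : ℤ → Point d → Fin d → ℤ
    numerator y x k = + M ℤ.* lookup x k ℤ.+ + lookup w k ℤ.* y

    -- With `s = n t`, these are the convex weights multiplied by `M s`, which turns them into
    -- integers at lattice points: `y` belongs to the vertex `n (M , - w)`, the numerators to the
    -- vertices `n e_k`, and the last inequality is nonnegativity of the weight left for the origin.
    ConeConditions : ℕ → Point (suc d) → Set
    ConeConditions s (y ∷ x) =
      + 0 ℤ.≤ y × (∀ k → + 0 ℤ.≤ numerator y x k) × (y ℤ.+ Σℤ (numerator y x) ℤ.≤ + (M ℕ.* s))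

    module _ (t′ : ℕ) where
      private
        τ = ι (+ suc t′)
        K = τ * (N′ * Mℚ)

        instance
          posT : ℚ.Positive τ
          posT = ι-pos t′
          posN : ℚ.Positive N′
          posN = ι-pos n′
          posM : ℚ.Positive Mℚ
          posM = ι-pos M′
          posNM : ℚ.Positive (N′ * Mℚ)
          posNM = ℚₚ.pos*pos⇒pos N′ Mℚ
          posK : ℚ.Positive K
          posK = ℚₚ.pos*pos⇒pos τ (N′ * Mℚ)
          nonZeroK : ℚ.NonZero K
          nonZeroK = ℚₚ.pos⇒nonZero K

        0≤K : 0ℚ ℚ.≤ K
        0≤K = ℚₚ.<⇒≤ (ℚₚ.positive⁻¹ K)

        ι-numerator : ∀ y x k → ι (numerator y x k) ≡ Mℚ * ι (lookup x k) + W k * ι y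
        ι-numerator y x k = trans (ι-homo-+ (+ M ℤ.* lookup x k) (+ lookup w k ℤ.* y)) (cong₂ _+_ (ι-homo-* (+ M) (lookup x k)) (ι-homo-* (+ lookup w k) y))

        ιMs≡K : ι (+ (M ℕ.* (n ℕ.* suc t′))) ≡ K
        ιMs≡K = trans (cong (λ z → ι (+ z)) (eq M n (suc t′))) (trans (cong ι (ℤₚ.pos-* (suc t′) (n ℕ.* M)))
          (trans (ι-homo-* (+ suc t′) (+ (n ℕ.* M))) (cong (_*_ τ) NM≡)))
          where
          eq : ∀ M n t → M ℕ.* (n ℕ.* t) ≡ t ℕ.* (n ℕ.* M)
          eq = ℕSolver.solve-∀

      inDilate⇒cone : ∀ x → InDilate polytope (suc t′) x → ConeConditions (n ℕ.* suc t′) x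
      inDilate⇒cone (y ∷ x) (c , c≥0 , Σc≡1 , eq) =
        ι-cancel-≤ (subst (ℚ._≤_ 0ℚ) (sym ιy≡) (*-nonNeg 0≤K (c≥0 (fs fz)))) ,
        (λ k → ι-cancel-≤ (subst (ℚ._≤_ 0ℚ) (sym (ιu≡ k)) (*-nonNeg 0≤K (c≥0 (fs (fs k)))))) ,
        ι-cancel-≤ (begin
          ι (y ℤ.+ Σℤ (numerator y x))    ≡⟨ ιΣ≡ ⟩
          K * rest                        ≤⟨ ℚₚ.*-monoˡ-≤-nonNeg K {{ℚ.nonNegative 0≤K}} rest≤1 ⟩
          K * 1ℚ                          ≡⟨ ℚₚ.*-identityʳ K ⟩
          K                               ≡⟨ ιMs≡K ⟨
          ι (+ (M ℕ.* (n ℕ.* suc t′)))    ∎)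
        where
        open ℚₚ.≤-Reasoning
        rest = Σℚ (c ∘ fs)
        head-eq : ι y ≡ τ * (c (fs fz) * (N′ * Mℚ))
        head-eq = trans (eq fz) (cong (_*_ τ) (trans (cong₂ _+_ (ℚₚ.*-zeroʳ (c fz)) (combination-head (c ∘ fs))) (ℚₚ.+-identityˡ (c (fs fz) * (N′ * Mℚ)))))
        tail-eq : ∀ k → ι (lookup x k) ≡ τ * (c (fs fz) * (- (N′ * W k)) + c (fs (fs k)) * N′)
        tail-eq k = trans (eq (fs k)) (cong (_*_ τ) (trans (cong₂ _+_
          (trans (cong (λ z → c fz * ι z) (Vecₚ.lookup-replicate k (+ 0))) (ℚₚ.*-zeroʳ (c fz))) (combination-tail (c ∘ fs) k)) (ℚₚ.+-identityˡ _)))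
        ιy≡ : ι y ≡ K * c (fs fz)
        ιy≡ = trans head-eq (eq′ τ N′ Mℚ (c (fs fz)))
          where
          eq′ : ∀ t n m c → t * (c * (n * m)) ≡ t * (n * m) * c
          eq′ = solve-∀ ℚ-ring
        ιu≡ : ∀ k → ι (numerator y x k) ≡ K * c (fs (fs k))
        ιu≡ k = trans (ι-numerator y x k) (trans (cong₂ (λ a b → Mℚ * a + W k * b) (tail-eq k) head-eq)
          (eq′ τ N′ Mℚ (W k) (c (fs fz)) (c (fs (fs k)))))
          where
          eq′ : ∀ t n m w a b → m * (t * (a * (- (n * w)) + b * n)) + w * (t * (a * (n * m))) ≡ t * (n * m) * b
          eq′ = solve-∀ ℚ-ring
        ιΣ≡ : ι (y ℤ.+ Σℤ (numerator y x)) ≡ K * rest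
        ιΣ≡ = trans (ι-homo-+ y (Σℤ (numerator y x))) (trans (cong₂ _+_ ιy≡
          (trans (ι-Σℤ (numerator y x)) (trans (Σℚ-cong ιu≡) (sym (*-distribˡ-Σℚ K (λ k → c (fs (fs k))))))))
          (sym (ℚₚ.*-distribˡ-+ K (c (fs fz)) (Σℚ (λ k → c (fs (fs k)))))))
        rest≤1 : rest ℚ.≤ 1ℚ
        rest≤1 = subst (ℚ._≤_ rest) Σc≡1 (subst (λ z → z ℚ.≤ c fz + rest) (ℚₚ.+-identityˡ rest) (ℚₚ.+-monoˡ-≤ rest (c≥0 fz)))

      cone⇒inDilate : ∀ x → ConeConditions (n ℕ.* suc t′) x → InDilate polytope (suc t′) x
      cone⇒inDilate (y ∷ x) (0≤y , 0≤u , Σ≤) = c , c≥0 , Σc≡1 , eq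
        where
        K⁻¹ = ℚ.1/ K
        0≤K⁻¹ : 0ℚ ℚ.≤ K⁻¹
        0≤K⁻¹ = ℚₚ.<⇒≤ (ℚₚ.positive⁻¹ K⁻¹ {{ℚₚ.1/pos⇒pos K}})
        u : Fin (suc d) → ℤ
        u fz     = y
        u (fs k) = numerator y x k
        c′ : Fin (suc d) → ℚ
        c′ i = ι (u i) * K⁻¹
        c : Fin (suc (suc d)) → ℚ
        -- The origin contributes to no coordinate, so its weight can absorb the slack.
        c fz     = 1ℚ - Σℚ c′
        c (fs i) = c′ i
        0≤u′ : ∀ i → + 0 ℤ.≤ u i
        0≤u′ fz     = 0≤y
        0≤u′ (fs k) = 0≤u k
        Σc′≤1 : Σℚ c′ ℚ.≤ 1ℚ
        Σc′≤1 = subst (λ z → z ℚ.≤ 1ℚ) (trans (cong (λ z → z * K⁻¹) (ι-Σℤ u)) (*-distribʳ-Σℚ K⁻¹ (ι ∘ u)))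
          (subst (λ z → ι (Σℤ u) * K⁻¹ ℚ.≤ z) (trans (cong (λ z → z * K⁻¹) ιMs≡K) (ℚₚ.*-inverseʳ K))
            (ℚₚ.*-monoʳ-≤-nonNeg K⁻¹ {{ℚ.nonNegative 0≤K⁻¹}} (ι-mono-≤ Σ≤)))
        c≥0 : ∀ i → 0ℚ ℚ.≤ c i
        c≥0 fz     = subst (λ z → z ℚ.≤ 1ℚ - Σℚ c′) (ℚₚ.+-inverseʳ (Σℚ c′)) (ℚₚ.+-monoˡ-≤ (- Σℚ c′) Σc′≤1)
        c≥0 (fs i) = *-nonNeg (ι-mono-≤ (0≤u′ i)) 0≤K⁻¹
        Σc≡1 : Σℚ c ≡ 1ℚ
        Σc≡1 = eq′ 1ℚ (Σℚ c′)
          where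
          eq′ : ∀ a b → a - b + b ≡ a
          eq′ = solve-∀ ℚ-ring
        eq : ∀ j → ι (lookup (y ∷ x) j) ≡ τ * Σℚ (λ i → c i * ι (lookup (vertex i) j))
        eq fz = sym (trans (cong (_*_ τ) (trans (cong₂ _+_ (ℚₚ.*-zeroʳ (c fz)) (combination-head c′)) (ℚₚ.+-identityˡ (c′ fz * (N′ * Mℚ)))))
          (trans (eq′ τ (N′ * Mℚ) (ι y) K⁻¹) (trans (cong (_*_ (ι y)) (ℚₚ.*-inverseʳ K)) (ℚₚ.*-identityʳ (ι y)))))
          where
          eq′ : ∀ t nm y k → t * (y * k * nm) ≡ y * (t * nm * k)
          eq′ = solve-∀ ℚ-ring
        eq (fs k) = sym (trans (cong (_*_ τ) (trans (cong₂ _+_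
            (trans (cong (λ z → c fz * ι z) (Vecₚ.lookup-replicate k (+ 0))) (ℚₚ.*-zeroʳ (c fz))) (combination-tail c′ k)) (ℚₚ.+-identityˡ _)))
          (trans (cong (λ z → τ * (ι y * K⁻¹ * (- (N′ * W k)) + z * K⁻¹ * N′)) (ι-numerator y x k))
          (trans (eq′ τ N′ Mℚ (W k) (ι y) (ι (lookup x k)) K⁻¹) (trans (cong (_*_ (ι (lookup x k))) (ℚₚ.*-inverseʳ K)) (ℚₚ.*-identityʳ (ι (lookup x k)))))))
          where
          eq′ : ∀ t n m w y x k → t * (y * k * (- (n * w)) + (m * x + w * y) * k * n) ≡ x * (t * (n * m) * k)
          eq′ = solve-∀ ℚ-ring

lookup-ext : ∀ {A : Set} {d} {x y : Vec A d} → (∀ k → lookup x k ≡ lookup y k) → x ≡ y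
lookup-ext {x = x} {y} eq = trans (sym (Vecₚ.tabulate∘lookup x)) (trans (Vecₚ.tabulate-cong eq) (Vecₚ.tabulate∘lookup y))

-- Parametrisation of the lattice points by a residue modulo M and a vector of naturals

module _ (S : Simplex) where
  open Simplex S

  -- As `numerator y x k` is congruent to `w_k y` modulo M, the class `j` of `y` determines the
  -- classes of all numerators. The number `j` and these residues, divided by M, are the coordinates
  -- of a point of the half-open fundamental parallelepiped.
  residue : ℕ → ℕ → ℕ
  residue j v = v ℕ.* j ℕ.% M

  residueSum : ℕ → ℕ
  residueSum j = j ℕ.+ Vec.sum (Vec.map (residue j) w)

  -- ⌈ residueSum j / M ⌉
  height : ℕ → ℕ
  height j = (residueSum j ℕ.+ M′) ℕ./ M

  -- Solves y = j + a₀ M and numerator y x k = M aₖ + residue j wₖ for y ∷ x.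
  point : ℕ → Vec ℕ (suc d) → Point (suc d)
  point j (a₀ ∷ a) = + (j ℕ.+ a₀ ℕ.* M) ∷
    Vec.tabulate (λ k → + lookup a k ℤ.- + (lookup w k ℕ.* a₀ ℕ.+ lookup w k ℕ.* j ℕ./ M))

  module _ where
    open import Data.Integer using (_+_; _*_; -_; _-_)

    -- The shift of `b` cancels exactly the multiples of M in `v (j + a₀ M)`, leaving the residue.
    -- An integer `b` is allowed because `cone⇒point` applies this before `b` is known to be
    -- nonnegative.
    numerator-shift : ∀ v j a₀ b → + M * (b - + (v ℕ.* a₀ ℕ.+ v ℕ.* j ℕ./ M)) + + v * + (j ℕ.+ a₀ ℕ.* M) ≡ + M * b + + residue j v
    numerator-shift v j a₀ b = begin
      + M * (b - + (v ℕ.* a₀ ℕ.+ q)) + + v * + (j ℕ.+ a₀ ℕ.* M)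
        ≡⟨ cong₂ (λ α β → + M * (b - (α + + q)) + + v * (+ j + β)) (ℤₚ.pos-* v a₀) (ℤₚ.pos-* a₀ M) ⟩
      + M * (b - (+ v * + a₀ + + q)) + + v * (+ j + + a₀ * + M)
        ≡⟨ ring₁ (+ M) b (+ v) (+ a₀) (+ q) (+ j) ⟩
      + M * b + (+ v * + j - + q * + M)
        ≡⟨ cong (λ z → + M * b + (z - + q * + M)) vj≡ ⟩
      + M * b + (+ residue j v + + q * + M - + q * + M)
        ≡⟨ cong (λ z → + M * b + z) (ring₂ (+ residue j v) (+ q * + M)) ⟩
      + M * b + + residue j v ∎
      where
      open ≡-Reasoning
      q = v ℕ.* j ℕ./ M
      vj≡ : + v * + j ≡ + residue j v + + q * + M
      vj≡ = trans (sym (ℤₚ.pos-* v j)) (trans (cong +_ (ℕᵈ.m≡m%n+[m/n]*n (v ℕ.* j) M)) (cong (λ z → + residue j v + z) (ℤₚ.pos-* q M)))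
      ring₁ : ∀ m b v a q j → m * (b - (v * a + q)) + v * (j + a * m) ≡ m * b + (v * j - q * m)
      ring₁ = ℤSolver.solve-∀
      ring₂ : ∀ r z → r + z - z ≡ r
      ring₂ = ℤSolver.solve-∀

    numerator-point : ∀ j a₀ (a : Vec ℕ d) k →
      numerator S (+ (j ℕ.+ a₀ ℕ.* M)) (Vec.tail (point j (a₀ ∷ a))) k ≡ + (M ℕ.* lookup a k ℕ.+ residue j (lookup w k))
    numerator-point j a₀ a k = trans
      (cong (λ z → + M * z + + lookup w k * + (j ℕ.+ a₀ ℕ.* M)) (Vecₚ.lookup∘tabulate _ k))
      (trans (numerator-shift (lookup w k) j a₀ (+ lookup a k)) (cong (λ z → z + + residue j (lookup w k)) (sym (ℤₚ.pos-* M (lookup a k)))))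

  Σℤ-residues : ∀ {e} j (v a : Vec ℕ e) (u : Fin e → ℤ) →
    (∀ k → u k ≡ + (M ℕ.* lookup a k ℕ.+ residue j (lookup v k))) →
    Σℤ u ≡ + (M ℕ.* Vec.sum a ℕ.+ Vec.sum (Vec.map (residue j) v))
  Σℤ-residues j []      []      u u≡ = cong +_ (sym (trans (ℕₚ.+-identityʳ (M ℕ.* 0)) (ℕₚ.*-zeroʳ M)))
  Σℤ-residues j (v ∷ vs) (a ∷ as) u u≡ = trans
    (cong₂ ℤ._+_ (u≡ fz) (Σℤ-residues j vs as (u ∘ fs) (u≡ ∘ fs)))
    (cong +_ (eq M a (residue j v) (Vec.sum as) (Vec.sum (Vec.map (residue j) vs))))
    where
    eq : ∀ m a r b s → (m ℕ.* a ℕ.+ r) ℕ.+ (m ℕ.* b ℕ.+ s) ≡ m ℕ.* (a ℕ.+ b) ℕ.+ (r ℕ.+ s)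
    eq = ℕSolver.solve-∀

  module _ where
    open import Data.Nat using (_+_; _*_; _/_; _%_; _∸_)

    total-point : ∀ j a₀ a → + (j + a₀ * M) ℤ.+ Σℤ (numerator S (+ (j + a₀ * M)) (Vec.tail (point j (a₀ ∷ a)))) ≡
                             + (M * (a₀ + Vec.sum a) + residueSum j)
    total-point j a₀ a = trans (cong (λ z → + (j + a₀ * M) ℤ.+ z) (Σℤ-residues j w a _ (numerator-point j a₀ a)))
      (cong +_ (eq j a₀ M (Vec.sum a) (Vec.sum (Vec.map (residue j) w))))
      where
      eq : ∀ j a₀ m s r → j + a₀ * m + (m * s + r) ≡ m * (a₀ + s) + (j + r)
      eq = ℕSolver.solve-∀

    -- Rounding `R / M` up loses nothing here, since the other terms are multiples of M; `ceiling⁻`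
    -- is the converse.
    ceiling⁺ : ∀ A s R → M * A + R ≤ M * s → (R + M′) / M + A ≤ s
    ceiling⁺ A s R le = begin
      (R + M′) / M + A ≤⟨ ℕₚ.+-monoˡ-≤ A (ℕ.s≤s⁻¹ (ℕᵈ.m<n*o⇒m/o<n {R + M′} {suc e} {M} bound)) ⟩
      e + A            ≡⟨ ℕₚ.m∸n+n≡m A≤s ⟩
      s                ∎
      where
      open ℕₚ.≤-Reasoning
      e = s ∸ A
      A≤s : A ≤ s
      A≤s = ℕₚ.*-cancelˡ-≤ M (ℕₚ.≤-trans (ℕₚ.m≤m+n (M * A) R) le)
      R≤ : R ≤ M * e
      R≤ = ℕₚ.+-cancelˡ-≤ (M * A) R (M * e) (subst (_≤_ (M * A + R)) (trans (cong (_*_ M) (sym (ℕₚ.m+[n∸m]≡n A≤s))) (ℕₚ.*-distribˡ-+ M A e)) le)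
      bound : R + M′ < suc e * M
      bound = begin-strict
        R + M′       ≤⟨ ℕₚ.+-monoˡ-≤ M′ R≤ ⟩
        M * e + M′   <⟨ ℕₚ.+-monoʳ-< (M * e) (ℕₚ.n<1+n M′) ⟩
        M * e + M    ≡⟨ eq M e ⟩
        suc e * M    ∎
        where
        eq : ∀ m e → m * e + m ≡ m + e * m
        eq = ℕSolver.solve-∀

    ceiling⁻ : ∀ A s R → (R + M′) / M + A ≤ s → M * A + R ≤ M * s
    ceiling⁻ A s R le = begin
      M * A + R                    ≤⟨ ℕₚ.+-monoʳ-≤ (M * A) R≤ ⟩
      M * A + h * M                ≡⟨ eq M A h ⟩
      M * (h + A)                  ≤⟨ ℕₚ.*-monoʳ-≤ M le ⟩
      M * s                        ∎
      where
      open ℕₚ.≤-Reasoning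
      h = (R + M′) / M
      eq : ∀ m a h → m * a + h * m ≡ m * (h + a)
      eq = ℕSolver.solve-∀
      R≤ : R ≤ h * M
      R≤ = ℕₚ.+-cancelʳ-≤ M′ R (h * M) (begin
        R + M′                ≡⟨ ℕᵈ.m≡m%n+[m/n]*n (R + M′) M ⟩
        (R + M′) % M + h * M  ≤⟨ ℕₚ.+-monoˡ-≤ (h * M) (ℕ.s≤s⁻¹ (ℕᵈ.m%n<n (R + M′) M)) ⟩
        M′ + h * M            ≡⟨ ℕₚ.+-comm M′ (h * M) ⟩
        h * M + M′            ∎)

  cone-point⁻ : ∀ s j a → ConeConditions S s (point j a) → height j ℕ.+ Vec.sum a ≤ s
  cone-point⁻ s j (a₀ ∷ a) (_ , _ , le) = ceiling⁺ (a₀ ℕ.+ Vec.sum a) s (residueSum j)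
    (ℤₚ.drop‿+≤+ (subst (ℤ._≤ + (M ℕ.* s)) (total-point j a₀ a) le))

  cone-point⁺ : ∀ s j a → height j ℕ.+ Vec.sum a ≤ s → ConeConditions S s (point j a)
  cone-point⁺ s j (a₀ ∷ a) le =
    ℤ.+≤+ z≤n ,
    (λ k → subst (ℤ._≤_ (+ 0)) (sym (numerator-point j a₀ a k)) (ℤ.+≤+ z≤n)) ,
    subst (ℤ._≤ + (M ℕ.* s)) (sym (total-point j a₀ a)) (ℤ.+≤+ (ceiling⁻ (a₀ ℕ.+ Vec.sum a) s (residueSum j) le))

  cone⇒point : ∀ s x → ConeConditions S s x → ∃ λ j → j < M × ∃ λ a → x ≡ point j a
  cone⇒point s (+ y ∷ x) (_ , 0≤u , _) = j , ℕᵈ.m%n<n y M , a₀ ∷ a ,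
    cong₂ _∷_ (cong +_ (ℕᵈ.m≡m%n+[m/n]*n y M)) (lookup-ext (λ k → trans (x≡ k) (sym (Vecₚ.lookup∘tabulate _ k))))
    where
    j = y ℕ.% M
    a₀ = y ℕ./ M
    shift : Fin d → ℕ
    shift k = lookup w k ℕ.* a₀ ℕ.+ lookup w k ℕ.* j ℕ./ M
    b : Fin d → ℤ
    b k = lookup x k ℤ.+ + shift k
    a : Vec ℕ d
    a = Vec.tabulate (λ k → ℤ.∣ b k ∣)
    unshift : ∀ z e → z ≡ z ℤ.+ e ℤ.- e
    unshift = ℤSolver.solve-∀
    numerator≡ : ∀ k → numerator S (+ y) x k ≡ + M ℤ.* b k ℤ.+ + residue j (lookup w k)
    numerator≡ k = trans
      (cong₂ (λ z y → + M ℤ.* z ℤ.+ + lookup w k ℤ.* + y) (unshift (lookup x k) (+ shift k)) (ℕᵈ.m≡m%n+[m/n]*n y M))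
      (numerator-shift (lookup w k) j a₀ (b k))
    -- The numerator is `M b + r` with `r < M`; for `b ≤ -1` it would be at most `r - M`, hence
    -- negative.
    0≤b : ∀ k → + 0 ℤ.≤ b k
    0≤b k = ℤₚ.≮⇒≥ λ b<0 → ℤₚ.<⇒≱ (begin-strict
      numerator S (+ y) x k  ≡⟨ numerator≡ k ⟩
      + M ℤ.* b k ℤ.+ + r    ≤⟨ ℤₚ.+-monoˡ-≤ (+ r) (ℤₚ.*-monoˡ-≤-nonNeg (+ M) (ℤₚ.i<j⇒i≤pred[j] b<0)) ⟩
      + M ℤ.* ℤ.-1ℤ ℤ.+ + r  ≡⟨ cong (ℤ._+ + r) (trans (ℤₚ.*-comm (+ M) ℤ.-1ℤ) (ℤₚ.-1*i≡-i (+ M))) ⟩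
      ℤ.- + M ℤ.+ + r        <⟨ ℤₚ.+-monoʳ-< (ℤ.- + M) (ℤ.+<+ (ℕᵈ.m%n<n (lookup w k ℕ.* j) M)) ⟩
      ℤ.- + M ℤ.+ + M        ≡⟨ ℤₚ.+-inverseˡ (+ M) ⟩
      + 0                    ∎) (0≤u k)
      where
      open ℤₚ.≤-Reasoning
      r = residue j (lookup w k)
    x≡ : ∀ k → lookup x k ≡ + lookup a k ℤ.- + shift k
    x≡ k = trans (unshift (lookup x k) (+ shift k)) (cong (ℤ._- + shift k)
      (sym (trans (cong +_ (Vecₚ.lookup∘tabulate _ k)) (ℤₚ.0≤i⇒+∣i∣≡i (0≤b k)))))
  cone⇒point s (-[1+ _ ] ∷ x) (() , _)

  point-injectiveˡ : ∀ {i j} (a b : Vec ℕ (suc d)) → i < M → j < M → point i a ≡ point j b → i ≡ j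
  point-injectiveˡ {i} {j} (a₀ ∷ _) (b₀ ∷ _) i<M j<M eq = begin
    i                          ≡⟨ ℕᵈ.m<n⇒m%n≡m i<M ⟨
    i ℕ.% M                    ≡⟨ ℕᵈ.[m+kn]%n≡m%n i a₀ M ⟨
    (i ℕ.+ a₀ ℕ.* M) ℕ.% M     ≡⟨ cong (ℕ._% M) (ℤₚ.+-injective (Vecₚ.∷-injectiveˡ eq)) ⟩
    (j ℕ.+ b₀ ℕ.* M) ℕ.% M     ≡⟨ ℕᵈ.[m+kn]%n≡m%n j b₀ M ⟩
    j ℕ.% M                    ≡⟨ ℕᵈ.m<n⇒m%n≡m j<M ⟩
    j                          ∎
    where open ≡-Reasoning

  point-injectiveʳ : ∀ j {a b} → point j a ≡ point j b → a ≡ b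
  point-injectiveʳ j {a₀ ∷ a} {b₀ ∷ b} eq
    with refl ← ℕₚ.*-cancelʳ-≡ a₀ b₀ M (ℕₚ.+-cancelˡ-≡ j _ _ (ℤₚ.+-injective (Vecₚ.∷-injectiveˡ eq))) =
    cong (a₀ ∷_) (lookup-ext λ k → ℤₚ.+-injective (∙-cancelʳ (ℤ.- + (lookup w k ℕ.* a₀ ℕ.+ lookup w k ℕ.* j ℕ./ M)) (+ lookup a k) (+ lookup b k)
      (trans (sym (Vecₚ.lookup∘tabulate _ k)) (trans (cong (λ v → lookup v k) (Vecₚ.∷-injectiveʳ eq)) (Vecₚ.lookup∘tabulate _ k)))))

  slice : ℕ → ℕ → List (Point (suc d))
  slice s j = List.map (point j) (shiftedPoints (suc d) (height j) s)

  -- `applyDownFrom` puts slice k in front when the bound grows from k to k + 1, in step with the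
  -- recursion of `tally`.
  points : ℕ → List (Point (suc d))
  points s = List.concat (List.applyDownFrom (slice s) M)

  points-unique : ∀ s → Unique (points s)
  points-unique s = Uniqueₚ.concat⁺
    (Allₚ.applyDownFrom⁺₂ (slice s) M (λ j → Uniqueₚ.map⁺ (point-injectiveʳ j) (shiftedPoints-unique (suc d) (height j) s)))
    (AllPairsₚ.applyDownFrom⁺₁ (slice s) M λ j<i i<M (x∈ , x∈′) → disjoint j<i i<M x∈ x∈′)
    where
    disjoint : ∀ {i j x} → j < i → i < M → x ∈ slice s i → ¬ x ∈ slice s j
    disjoint {i} {j} j<i i<M x∈ x∈′ with ∈ₚ.∈-map⁻ (point i) x∈ | ∈ₚ.∈-map⁻ (point j) x∈′
    ... | a , _ , refl | b , _ , eq = ℕₚ.<⇒≢ j<i (sym (point-injectiveˡ a b i<M (ℕₚ.<-trans j<i i<M) eq))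

  ∈-points⇔cone : ∀ s x → x ∈ points s ⇔ ConeConditions S s x
  ∈-points⇔cone s x = mk⇔ to from
    where
    to : x ∈ points s → ConeConditions S s x
    to x∈ with _ , x∈slice , slice∈ ← ∈ₚ.∈-concat⁻′ (List.applyDownFrom (slice s) M) x∈
          with j , _ , refl ← ∈ₚ.∈-applyDownFrom⁻ (slice s) slice∈
          with a , a∈ , refl ← ∈ₚ.∈-map⁻ (point j) x∈slice = cone-point⁺ s j a (∈-shiftedPoints⁻ (height j) s a∈)
    from : ConeConditions S s x → x ∈ points s
    from cone with j , j<M , a , refl ← cone⇒point s x cone =
      ∈ₚ.∈-concat⁺′ (∈ₚ.∈-map⁺ (point j) (∈-shiftedPoints⁺ (height j) s a (cone-point⁻ s j a cone)))
        (∈ₚ.∈-applyDownFrom⁺ (slice s) j<M)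

  latticeCount-polytope : ∀ t → LatticeCount (polytope S) (suc t) (length (points (n ℕ.* suc t)))
  latticeCount-polytope t = points s , points-unique s ,
    (λ x → mk⇔ (cone⇒inDilate S t x ∘ Equivalence.to (∈-points⇔cone s x)) (Equivalence.from (∈-points⇔cone s x) ∘ inDilate⇒cone S t x)) , refl
    where s = n ℕ.* suc t

  -- All d + 1 summands of `residueSum j` are at most M - 1. This bound is what
  -- `length-shiftedPoints` needs for its count to be polynomial even where s is smaller than the
  -- height.
  height≤suc-d : ∀ {j} → j < M → height j ≤ suc d
  height≤suc-d {j} j<M = ℕ.s≤s⁻¹ (ℕᵈ.m<n*o⇒m/o<n {residueSum j ℕ.+ M′} {suc (suc d)} {M} (begin-strict
    residueSum j ℕ.+ M′                ≤⟨ ℕₚ.+-monoˡ-≤ M′ (ℕₚ.+-mono-≤ (ℕ.s≤s⁻¹ j<M) (residues≤ w)) ⟩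
    M′ ℕ.+ d ℕ.* M′ ℕ.+ M′             <⟨ ℕₚ.m<m+n _ (s≤s z≤n) ⟩
    M′ ℕ.+ d ℕ.* M′ ℕ.+ M′ ℕ.+ suc (suc d) ≡⟨ eq d M′ ⟩
    suc (suc d) ℕ.* M                  ∎))
    where
    open ℕₚ.≤-Reasoning
    residues≤ : ∀ {e} (v : Vec ℕ e) → Vec.sum (Vec.map (residue j) v) ≤ e ℕ.* M′
    residues≤ []       = z≤n
    residues≤ (v ∷ vs) = ℕₚ.+-mono-≤ (ℕ.s≤s⁻¹ (ℕᵈ.m%n<n (v ℕ.* j) M)) (residues≤ vs)
    eq : ∀ d m → m ℕ.+ d ℕ.* m ℕ.+ m ℕ.+ (2 ℕ.+ d) ≡ (2 ℕ.+ d) ℕ.* (1 ℕ.+ m)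
    eq = ℕSolver.solve-∀

-- Ehrhart polynomials

module _ where
  open import Data.Integer using (_+_; _*_; -_; _-_)

  infixl 6 _⊞_
  infixl 7 _⊡_ _⊠_

  -- Polynomials over ℤ as lists of coefficients, constant coefficient first.
  ⟦_⟧ : List ℤ → ℤ → ℤ
  ⟦ []    ⟧ t = + 0
  ⟦ a ∷ p ⟧ t = a + t * ⟦ p ⟧ t

  _⊞_ : List ℤ → List ℤ → List ℤ
  []      ⊞ q       = q
  (a ∷ p) ⊞ []      = a ∷ p
  (a ∷ p) ⊞ (b ∷ q) = a + b ∷ p ⊞ q

  _⊡_ : ℤ → List ℤ → List ℤ
  a ⊡ p = List.map (a *_) p

  _⊠_ : List ℤ → List ℤ → List ℤ
  []      ⊠ q = []
  (a ∷ p) ⊠ q = a ⊡ q ⊞ (+ 0 ∷ p ⊠ q)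

  ⟦⊞⟧ : ∀ p q t → ⟦ p ⊞ q ⟧ t ≡ ⟦ p ⟧ t + ⟦ q ⟧ t
  ⟦⊞⟧ []      q       t = sym (ℤₚ.+-identityˡ (⟦ q ⟧ t))
  ⟦⊞⟧ (a ∷ p) []      t = sym (ℤₚ.+-identityʳ (⟦ a ∷ p ⟧ t))
  ⟦⊞⟧ (a ∷ p) (b ∷ q) t = trans (cong (λ z → a + b + t * z) (⟦⊞⟧ p q t)) (eq a b t (⟦ p ⟧ t) (⟦ q ⟧ t))
    where
    eq : ∀ a b t x y → a + b + t * (x + y) ≡ a + t * x + (b + t * y)
    eq = ℤSolver.solve-∀

  ⟦⊡⟧ : ∀ a p t → ⟦ a ⊡ p ⟧ t ≡ a * ⟦ p ⟧ t
  ⟦⊡⟧ a []      t = sym (ℤₚ.*-zeroʳ a)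
  ⟦⊡⟧ a (b ∷ p) t = trans (cong (λ z → a * b + t * z) (⟦⊡⟧ a p t)) (eq a b t (⟦ p ⟧ t))
    where
    eq : ∀ a b t x → a * b + t * (a * x) ≡ a * (b + t * x)
    eq = ℤSolver.solve-∀

  ⟦⊠⟧ : ∀ p q t → ⟦ p ⊠ q ⟧ t ≡ ⟦ p ⟧ t * ⟦ q ⟧ t
  ⟦⊠⟧ []      q t = refl
  ⟦⊠⟧ (a ∷ p) q t = trans (⟦⊞⟧ (a ⊡ q) (+ 0 ∷ p ⊠ q) t)
    (trans (cong₂ (λ x y → x + (+ 0 + t * y)) (⟦⊡⟧ a q t) (⟦⊠⟧ p q t)) (eq a t (⟦ p ⟧ t) (⟦ q ⟧ t)))
    where
    eq : ∀ a t x y → a * y + (+ 0 + t * (x * y)) ≡ (a + t * x) * y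
    eq = ℤSolver.solve-∀

  risingPoly : ℕ → ℕ → ℕ → List ℤ
  risingPoly zero    l n = + 1 ∷ []
  risingPoly (suc d) l n = risingPoly d l n ⊠ (+ suc d - + l ∷ + n ∷ [])

  ⟦risingPoly⟧ : ∀ d l n t → ⟦ risingPoly d l n ⟧ t ≡ rising d (+ n * t - + l)
  ⟦risingPoly⟧ zero    l n t = trans (cong (λ z → + 1 + z) (ℤₚ.*-zeroʳ t)) refl
  ⟦risingPoly⟧ (suc d) l n t = trans (⟦⊠⟧ (risingPoly d l n) _ t)
    (cong₂ _*_ (⟦risingPoly⟧ d l n t) (eq (+ suc d) (+ l) (+ n) t))
    where
    eq : ∀ d l n t → d - l + t * (n + t * + 0) ≡ n * t - l + d
    eq = ℤSolver.solve-∀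

  bump : ℕ → List ℕ → List ℕ
  bump zero    []       = 1 ∷ []
  bump zero    (x ∷ hs) = suc x ∷ hs
  bump (suc l) []       = 0 ∷ bump l []
  bump (suc l) (x ∷ hs) = x ∷ bump l hs

  weightedSum : List ℕ → (ℕ → ℤ) → ℤ
  weightedSum []       g = + 0
  weightedSum (x ∷ hs) g = + x * g 0 + weightedSum hs (g ∘ suc)

  weightedSum-cong : ∀ hs {f g : ℕ → ℤ} → (∀ i → f i ≡ g i) → weightedSum hs f ≡ weightedSum hs g
  weightedSum-cong []       f≗g = refl
  weightedSum-cong (x ∷ hs) f≗g = cong₂ _+_ (cong (+ x *_) (f≗g 0)) (weightedSum-cong hs (f≗g ∘ suc))

  weightedSum-bump : ∀ l hs g → weightedSum (bump l hs) g ≡ g l + weightedSum hs g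
  weightedSum-bump zero    []       g = cong (λ z → z + + 0) (ℤₚ.*-identityˡ (g 0))
  weightedSum-bump zero    (x ∷ hs) g = eq (+ x) (g 0) (weightedSum hs (g ∘ suc))
    where
    eq : ∀ x y z → (+ 1 + x) * y + z ≡ y + (x * y + z)
    eq = ℤSolver.solve-∀
  weightedSum-bump (suc l) []       g = trans (ℤₚ.+-identityˡ _) (weightedSum-bump l [] (g ∘ suc))
  weightedSum-bump (suc l) (x ∷ hs) g = trans (cong (λ z → + x * g 0 + z) (weightedSum-bump l hs (g ∘ suc)))
    (eq (+ x * g 0) (g (suc l)) (weightedSum hs (g ∘ suc)))
    where
    eq : ∀ x y z → x + (y + z) ≡ y + (x + z)
    eq = ℤSolver.solve-∀

  combination : ℕ → ℕ → List ℕ → ℕ → List ℤ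
  combination d n []       l = []
  combination d n (x ∷ hs) l = + x ⊡ risingPoly d l n ⊞ combination d n hs (suc l)

  ⟦combination⟧ : ∀ d n hs l t → ⟦ combination d n hs l ⟧ t ≡ weightedSum hs (λ i → rising d (+ n * t - + (i ℕ.+ l)))
  ⟦combination⟧ d n []       l t = refl
  ⟦combination⟧ d n (x ∷ hs) l t = trans (⟦⊞⟧ (+ x ⊡ risingPoly d l n) _ t) (cong₂ _+_
    (trans (⟦⊡⟧ (+ x) (risingPoly d l n) t) (cong (+ x *_) (⟦risingPoly⟧ d l n t)))
    (trans (⟦combination⟧ d n hs (suc l) t) (weightedSum-cong hs (λ i → cong (λ k → rising d (+ n * t - + k)) (ℕₚ.+-suc i l)))))

  module _ (S : Simplex) where
    open Simplex S

    -- tally M is the h*-vector of the simplex if n = 1.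
    tally : ℕ → List ℕ
    tally zero    = []
    tally (suc k) = bump (height S k) (tally k)

    -- This is (d + 1)! times the Ehrhart polynomial. Grouping by height leaves at most d + 2 rising
    -- products to expand, however large M is.
    simplexPoly : List ℤ
    simplexPoly = combination (suc d) n (tally M) 0

    length-slices : ∀ s k → k ≤ M → + (suc d !) * + length (List.concat (List.applyDownFrom (slice S s) k)) ≡
      weightedSum (tally k) (λ l → rising (suc d) (+ s - + l))
    length-slices s zero    _   = ℤₚ.*-zeroʳ (+ (suc d !))
    length-slices s (suc k) k<M = begin
      + (suc d !) * + length (slice S s k List.++ rest)
        ≡⟨ cong (λ z → + (suc d !) * + z) (trans (Listₚ.length-++ (slice S s k)) (cong (ℕ._+ length rest) (Listₚ.length-map (point S k) shifted))) ⟩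
      + (suc d !) * (+ length shifted + + length rest)
        ≡⟨ ℤₚ.*-distribˡ-+ (+ (suc d !)) (+ length shifted) (+ length rest) ⟩
      + (suc d !) * + length shifted + + (suc d !) * + length rest
        ≡⟨ cong₂ _+_ (length-shiftedPoints (suc d) (height S k) s (height≤suc-d S k<M)) (length-slices s k (ℕₚ.<⇒≤ k<M)) ⟩
      g (height S k) + weightedSum (tally k) g
        ≡⟨ weightedSum-bump (height S k) (tally k) g ⟨
      weightedSum (tally (suc k)) g ∎
      where
      open ≡-Reasoning
      shifted = shiftedPoints (suc d) (height S k) s
      rest = List.concat (List.applyDownFrom (slice S s) k)
      g : ℕ → ℤ
      g l = rising (suc d) (+ s - + l)

    ⟦simplexPoly⟧ : ∀ t → ⟦ simplexPoly ⟧ (+ t) ≡ + (suc d !) * + length (points S (n ℕ.* t))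
    ⟦simplexPoly⟧ t = trans (⟦combination⟧ (suc d) n (tally M) 0 (+ t)) (trans
      (weightedSum-cong (tally M) (λ i → cong₂ (λ a b → rising (suc d) (a - + b)) (sym (ℤₚ.pos-* n t)) (ℕₚ.+-identityʳ i)))
      (sym (length-slices (n ℕ.* t) M ℕₚ.≤-refl)))

  dimension : List Simplex → ℕ
  dimension []       = 0
  dimension (S ∷ Ss) = suc (Simplex.d S) ℕ.+ dimension Ss

  origin : IntegralPolytope 0
  origin .m     = 0
  origin .gen _ = []

  product : (Ss : List Simplex) → IntegralPolytope (dimension Ss)
  product []       = origin
  product (S ∷ Ss) = polytope S ⊗ product Ss

  -- The positive factor by which `productPoly` exceeds the Ehrhart polynomial; signs can therefore
  -- be read off over ℤ.
  denominator : List Simplex → ℕ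
  denominator []       = 1
  denominator (S ∷ Ss) = suc (Simplex.d S) ! ℕ.* denominator Ss

  productPoly : List Simplex → List ℤ
  productPoly []       = + 1 ∷ []
  productPoly (S ∷ Ss) = simplexPoly S ⊠ productPoly Ss

  fullDimensional-product : ∀ Ss → FullDimensional (product Ss)
  fullDimensional-product []       = (λ ()) , (λ ()) , λ _ _ ()
  fullDimensional-product (S ∷ Ss) = fullDimensional-⊗ {P = polytope S} {product Ss} (fullDimensional S) (fullDimensional-product Ss)

  latticeCount-product : ∀ Ss t → Σ ℕ λ c →
    LatticeCount (product Ss) (suc t) c × + denominator Ss * + c ≡ ⟦ productPoly Ss ⟧ (+ suc t)
  latticeCount-product []       t = 1 , ([] ∷ [] , [] ∷ [] , mem , refl) , sym (cong (λ z → + 1 + z) (ℤₚ.*-zeroʳ (+ suc t)))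
    where
    mem : ∀ x → x ∈ ([] ∷ []) ⇔ InDilate origin (suc t) x
    mem [] = mk⇔ (λ _ → (λ _ → 1ℚ) , (λ _ → ι-mono-≤ (ℤ.+≤+ {0} {1} z≤n)) , refl , λ ()) (λ _ → here refl)
  latticeCount-product (S ∷ Ss) t with latticeCount-product Ss t
  ... | c , count , eq = a ℕ.* c , latticeCount-⊗ (polytope S) (product Ss) {suc t} {a} {c} (latticeCount-polytope S t) count , (begin
    + (f ℕ.* D) * + (a ℕ.* c)                            ≡⟨ cong₂ _*_ (ℤₚ.pos-* f D) (ℤₚ.pos-* a c) ⟩
    + f * + D * (+ a * + c)                              ≡⟨ swap (+ f) (+ D) (+ a) (+ c) ⟩
    + f * + a * (+ D * + c)                              ≡⟨ cong₂ _*_ (sym (⟦simplexPoly⟧ S (suc t))) eq ⟩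
    ⟦ simplexPoly S ⟧ (+ suc t) * ⟦ productPoly Ss ⟧ (+ suc t) ≡⟨ ⟦⊠⟧ (simplexPoly S) (productPoly Ss) (+ suc t) ⟨
    ⟦ productPoly (S ∷ Ss) ⟧ (+ suc t)                   ∎)
    where
    open ≡-Reasoning
    f = suc (Simplex.d S) !
    D = denominator Ss
    a = length (points S (Simplex.n S ℕ.* suc t))
    swap : ∀ f d a c → f * d * (a * c) ≡ f * a * (d * c)
    swap = ℤSolver.solve-∀

denominator≢0 : ∀ Ss → ℕ.NonZero (denominator Ss)
denominator≢0 []       = _
denominator≢0 (S ∷ Ss) = ℕₚ.m*n≢0 (suc (Simplex.d S) !) (denominator Ss) {{suc (Simplex.d S) ℕₚ.!≢0}} {{denominator≢0 Ss}}

-- The default 0 past the end lets a list be summed up to any larger degree bound.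
coefficient : List ℤ → ℕ → ℤ
coefficient []      k       = + 0
coefficient (a ∷ p) zero    = a
coefficient (a ∷ p) (suc k) = coefficient p k

-- A sign pattern marks the negative coefficients with true.
hasSign : Bool → ℤ → Bool
hasSign true  -[1+ _ ]  = true
hasSign false (+ suc _) = true
hasSign _     _         = false

module _ where
  open import Data.Rational using (_+_; _*_; -_; _-_)

  Σℚ-coefficients : ∀ p {e} t → length p ≤ e →
    Σℚ {e} (λ k → ι (coefficient p (toℕ k)) * ι (+ (t ℕ.^ toℕ k))) ≡ ι (⟦ p ⟧ (+ t))
  Σℚ-coefficients []      {e}     t _         = trans (Σℚ-cong {e} (λ k → ℚₚ.*-zeroˡ (ι (+ (t ℕ.^ toℕ k))))) (Σℚ-zero e)
  Σℚ-coefficients (a ∷ p) {suc e} t (s≤s p≤e) = begin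
    ι a * 1ℚ + Σℚ {e} (λ k → ι (coefficient p (toℕ k)) * ι (+ (t ℕ.* t ℕ.^ toℕ k)))
      ≡⟨ cong₂ _+_ (ℚₚ.*-identityʳ (ι a)) (Σℚ-cong shift) ⟩
    ι a + Σℚ (λ k → ι (+ t) * term k)
      ≡⟨ cong (λ z → ι a + z) (*-distribˡ-Σℚ (ι (+ t)) term) ⟨
    ι a + ι (+ t) * Σℚ term
      ≡⟨ cong (λ z → ι a + ι (+ t) * z) (Σℚ-coefficients p t p≤e) ⟩
    ι a + ι (+ t) * ι (⟦ p ⟧ (+ t))
      ≡⟨ cong (λ z → ι a + z) (ι-homo-* (+ t) (⟦ p ⟧ (+ t))) ⟨
    ι a + ι (+ t ℤ.* ⟦ p ⟧ (+ t))
      ≡⟨ ι-homo-+ a (+ t ℤ.* ⟦ p ⟧ (+ t)) ⟨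
    ι (⟦ a ∷ p ⟧ (+ t)) ∎
    where
    open ≡-Reasoning
    swap : ∀ c t u → c * (t * u) ≡ t * (c * u)
    swap = solve-∀ ℚ-ring
    term : Fin e → ℚ
    term k = ι (coefficient p (toℕ k)) * ι (+ (t ℕ.^ toℕ k))
    shift : ∀ k → ι (coefficient p (toℕ k)) * ι (+ (t ℕ.* t ℕ.^ toℕ k)) ≡ ι (+ t) * term k
    shift k = trans
      (cong (λ z → ι (coefficient p (toℕ k)) * z) (trans (cong ι (ℤₚ.pos-* t (t ℕ.^ toℕ k))) (ι-homo-* (+ t) (+ (t ℕ.^ toℕ k)))))
      (swap (ι (coefficient p (toℕ k))) (ι (+ t)) (ι (+ (t ℕ.^ toℕ k))))

  module _ (Ss : List Simplex) where
    private
      Dℚ = ι (+ denominator Ss)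
      instance
        posD : ℚ.Positive Dℚ
        posD = ℚₚ.normalize-pos (denominator Ss) 1 {{_}} {{denominator≢0 Ss}}
        nonZeroD : ℚ.NonZero Dℚ
        nonZeroD = ℚₚ.pos⇒nonZero Dℚ
        posD⁻¹ : ℚ.Positive (ℚ.1/ Dℚ)
        posD⁻¹ = ℚₚ.1/pos⇒pos Dℚ

    ehrhartCoefficient : ℕ → ℚ
    ehrhartCoefficient k = ι (coefficient (productPoly Ss) k) * ℚ.1/ Dℚ

    isEhrhart-product : ∀ {e} → length (productPoly Ss) ≤ suc e → IsEhrhart {d = e} (product Ss) (ehrhartCoefficient ∘ toℕ)
    isEhrhart-product {e} len t with latticeCount-product Ss t
    ... | c , count , eq = c , count , (begin
      ι (+ c)                                        ≡⟨ ℚₚ.*-identityˡ (ι (+ c)) ⟨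
      1ℚ * ι (+ c)                                   ≡⟨ cong (λ z → z * ι (+ c)) (ℚₚ.*-inverseʳ Dℚ) ⟨
      Dℚ * ℚ.1/ Dℚ * ι (+ c)                         ≡⟨ swap Dℚ (ℚ.1/ Dℚ) (ι (+ c)) ⟩
      Dℚ * ι (+ c) * ℚ.1/ Dℚ                         ≡⟨ cong (λ z → z * ℚ.1/ Dℚ) (trans (sym (ι-homo-* (+ denominator Ss) (+ c))) (cong ι eq)) ⟩
      ι (⟦ productPoly Ss ⟧ (+ suc t)) * ℚ.1/ Dℚ     ≡⟨ cong (λ z → z * ℚ.1/ Dℚ) (Σℚ-coefficients (productPoly Ss) (suc t) len) ⟨
      Σℚ (λ k → a k * b k) * ℚ.1/ Dℚ                 ≡⟨ *-distribʳ-Σℚ (ℚ.1/ Dℚ) (λ k → a k * b k) ⟩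
      Σℚ (λ k → a k * b k * ℚ.1/ Dℚ)                 ≡⟨ Σℚ-cong (λ k → swap (a k) (b k) (ℚ.1/ Dℚ)) ⟩
      Σℚ (λ k → a k * ℚ.1/ Dℚ * b k)                 ∎)
      where
      open ≡-Reasoning
      a b : Fin (suc e) → ℚ
      a k = ι (coefficient (productPoly Ss) (toℕ k))
      b k = ι (+ (suc t ℕ.^ toℕ k))
      swap : ∀ x y z → x * y * z ≡ x * z * y
      swap = solve-∀ ℚ-ring

    ehrhartCoefficient-pos : ∀ k → T (hasSign false (coefficient (productPoly Ss) k)) → 0ℚ <ℚ ehrhartCoefficient k
    ehrhartCoefficient-pos k h with coefficient (productPoly Ss) k
    ... | + suc m = ℚₚ.positive⁻¹ (ι (+ suc m) * ℚ.1/ Dℚ) {{ℚₚ.pos*pos⇒pos (ι (+ suc m)) {{ι-pos m}} (ℚ.1/ Dℚ)}}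

    ehrhartCoefficient-neg : ∀ k → T (hasSign true (coefficient (productPoly Ss) k)) → ehrhartCoefficient k <ℚ 0ℚ
    ehrhartCoefficient-neg k h with coefficient (productPoly Ss) k
    ... | -[1+ m ] = ℚₚ.negative⁻¹ (ι -[1+ m ] * ℚ.1/ Dℚ) {{ℚₚ.neg*pos⇒neg (ι -[1+ m ]) {{ι-neg m}} (ℚ.1/ Dℚ)}}

-- Verification of all sign patterns by evaluation

hasSigns : ∀ {e} → Vec Bool e → List ℤ → Bool
hasSigns []       []      = true
hasSigns (b ∷ bs) (a ∷ p) = hasSign b a ∧ hasSigns bs p
hasSigns _        _       = false

-- The sign check rejects lists of the wrong length, so it also supplies the degree bound required
-- by `isEhrhart-product`.
hasSigns⇒length : ∀ {e} (bs : Vec Bool e) p → T (hasSigns bs p) → length p ≡ e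
hasSigns⇒length []       []      _ = refl
hasSigns⇒length (b ∷ bs) (a ∷ p) h = cong suc (hasSigns⇒length bs p (proj₂ (Equivalence.to T-∧ h)))

hasSigns⇒hasSign : ∀ {e} (bs : Vec Bool e) p → T (hasSigns bs p) → ∀ k → T (hasSign (lookup bs k) (coefficient p (toℕ k)))
hasSigns⇒hasSign (b ∷ bs) (a ∷ p) h fz     = proj₁ (Equivalence.to T-∧ h)
hasSigns⇒hasSign (b ∷ bs) (a ∷ p) h (fs k) = hasSigns⇒hasSign bs p (proj₂ (Equivalence.to T-∧ h)) k

-- The coefficients of t⁰, t⁸ and t⁹ are positive in every pattern.
extended : Vec Bool 7 → Vec Bool 10
extended s = false ∷ s ++ false ∷ false ∷ []

realises : Vec Bool 7 → List Simplex → Bool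
realises s Ss = (dimension Ss ℕ.≡ᵇ 9) ∧ hasSigns (extended s) (productPoly Ss)

-- The order is that of binary numerals whose leading digit belongs to `t¹`, so row r of `table`,
-- counted from 0, serves the pattern that spells r in binary.
patterns : ∀ e → List (Vec Bool e)
patterns zero    = [] ∷ []
patterns (suc e) = List.map (false ∷_) (patterns e) List.++ List.map (true ∷_) (patterns e)

∈-patterns : ∀ {e} (s : Vec Bool e) → s ∈ patterns e
∈-patterns []          = here refl
∈-patterns (false ∷ s) = ∈ₚ.∈-++⁺ˡ (∈ₚ.∈-map⁺ (false ∷_) (∈-patterns s))
∈-patterns (true  ∷ s) = ∈ₚ.∈-++⁺ʳ (List.map (false ∷_) (patterns _)) (∈ₚ.∈-map⁺ (true ∷_) (∈-patterns s))

allRealised : List (Vec Bool 7) → List (List Simplex) → Bool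
allRealised []       _          = true
allRealised (s ∷ ss) []         = false
allRealised (s ∷ ss) (Ss ∷ Sss) = realises s Ss ∧ allRealised ss Sss

allRealised⇒realises : ∀ ss Sss → T (allRealised ss Sss) → ∀ {s} → s ∈ ss → ∃ λ Ss → T (realises s Ss)
allRealised⇒realises (s ∷ ss) (Ss ∷ Sss) h (here refl) = Ss , proj₁ (Equivalence.to T-∧ h)
allRealised⇒realises (s ∷ ss) (Ss ∷ Sss) h (there s∈)  = allRealised⇒realises ss Sss (proj₂ (Equivalence.to (T-∧ {realises s Ss}) h)) s∈

-- Found by random search.  The rows follow the order of patterns 7, and Δ (n - 1) (M - 1) w stands for
-- n Δ(M, w).  Products of three tetrahedra were found for every pattern but {1, 3, 5, 7}.
table : List (List Simplex)
table =
  -- No negative coefficient: the cube of `(t + 1) (t + 2) (t + 3) / 6`, from three unimodular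
  -- tetrahedra.
  (Δ 0 0 (0 ∷ 0 ∷ []) ∷ Δ 0 0 (0 ∷ 0 ∷ []) ∷ Δ 0 0 (0 ∷ 0 ∷ []) ∷ []) ∷
  (Δ 5 3 (1 ∷ 3 ∷ []) ∷ Δ 7 3 (1 ∷ 3 ∷ []) ∷ Δ 0 16 (15 ∷ 16 ∷ []) ∷ []) ∷
  (Δ 2 1 (0 ∷ 1 ∷ []) ∷ Δ 6 3 (1 ∷ 3 ∷ []) ∷ Δ 0 23 (1 ∷ 23 ∷ []) ∷ []) ∷
  (Δ 7 1 (1 ∷ 1 ∷ []) ∷ Δ 4 2 (2 ∷ 1 ∷ []) ∷ Δ 0 25 (7 ∷ 25 ∷ []) ∷ []) ∷
  (Δ 0 0 (0 ∷ 0 ∷ []) ∷ Δ 7 3 (1 ∷ 3 ∷ []) ∷ Δ 0 21 (1 ∷ 21 ∷ []) ∷ []) ∷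
  (Δ 3 3 (3 ∷ 3 ∷ []) ∷ Δ 3 4 (3 ∷ 3 ∷ []) ∷ Δ 0 26 (1 ∷ 26 ∷ []) ∷ []) ∷
  (Δ 2 1 (0 ∷ 1 ∷ []) ∷ Δ 5 3 (1 ∷ 3 ∷ []) ∷ Δ 0 24 (1 ∷ 24 ∷ []) ∷ []) ∷
  (Δ 3 3 (1 ∷ 3 ∷ []) ∷ Δ 3 3 (1 ∷ 3 ∷ []) ∷ Δ 0 28 (1 ∷ 28 ∷ []) ∷ []) ∷
  (Δ 0 0 (0 ∷ 0 ∷ []) ∷ Δ 3 1 (0 ∷ 1 ∷ []) ∷ Δ 0 23 (5 ∷ 23 ∷ []) ∷ []) ∷
  (Δ 3 4 (3 ∷ 2 ∷ []) ∷ Δ 0 14 (1 ∷ 14 ∷ []) ∷ Δ 0 16 (1 ∷ 16 ∷ []) ∷ []) ∷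
  (Δ 6 0 (0 ∷ 0 ∷ []) ∷ Δ 1 6 (6 ∷ 4 ∷ []) ∷ Δ 0 28 (1 ∷ 28 ∷ []) ∷ []) ∷
  (Δ 5 1 (1 ∷ 1 ∷ []) ∷ Δ 1 8 (8 ∷ 7 ∷ []) ∷ Δ 0 28 (1 ∷ 28 ∷ []) ∷ []) ∷
  (Δ 0 0 (0 ∷ 0 ∷ []) ∷ Δ 6 3 (1 ∷ 3 ∷ []) ∷ Δ 0 22 (1 ∷ 22 ∷ []) ∷ []) ∷
  (Δ 5 3 (3 ∷ 3 ∷ []) ∷ Δ 1 5 (1 ∷ 5 ∷ []) ∷ Δ 0 28 (1 ∷ 28 ∷ []) ∷ []) ∷
  (Δ 4 0 (0 ∷ 0 ∷ []) ∷ Δ 3 2 (1 ∷ 2 ∷ []) ∷ Δ 0 28 (2 ∷ 28 ∷ []) ∷ []) ∷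
  (Δ 3 3 (3 ∷ 3 ∷ []) ∷ Δ 2 4 (3 ∷ 4 ∷ []) ∷ Δ 0 29 (1 ∷ 29 ∷ []) ∷ []) ∷
  (Δ 0 1 (0 ∷ 1 ∷ []) ∷ Δ 0 2 (0 ∷ 2 ∷ []) ∷ Δ 0 23 (1 ∷ 23 ∷ []) ∷ []) ∷
  (Δ 6 1 (0 ∷ 1 ∷ []) ∷ Δ 0 18 (1 ∷ 18 ∷ []) ∷ Δ 0 18 (5 ∷ 18 ∷ []) ∷ []) ∷
  (Δ 3 0 (0 ∷ 0 ∷ []) ∷ Δ 0 16 (1 ∷ 16 ∷ []) ∷ Δ 0 21 (1 ∷ 21 ∷ []) ∷ []) ∷
  (Δ 5 1 (0 ∷ 1 ∷ []) ∷ Δ 0 18 (3 ∷ 18 ∷ []) ∷ Δ 0 19 (1 ∷ 19 ∷ []) ∷ []) ∷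
  (Δ 1 3 (0 ∷ 3 ∷ []) ∷ Δ 1 6 (6 ∷ 4 ∷ []) ∷ Δ 0 28 (1 ∷ 28 ∷ []) ∷ []) ∷
  (Δ 3 4 (1 ∷ 2 ∷ []) ∷ Δ 1 16 (1 ∷ 13 ∷ []) ∷ Δ 0 30 (1 ∷ 30 ∷ []) ∷ []) ∷
  (Δ 3 0 (0 ∷ 0 ∷ []) ∷ Δ 1 7 (7 ∷ 7 ∷ []) ∷ Δ 0 29 (29 ∷ 29 ∷ []) ∷ []) ∷
  (Δ 3 2 (1 ∷ 1 ∷ []) ∷ Δ 1 11 (1 ∷ 11 ∷ []) ∷ Δ 0 32 (1 ∷ 32 ∷ []) ∷ []) ∷
  (Δ 0 0 (0 ∷ 0 ∷ []) ∷ Δ 2 1 (0 ∷ 1 ∷ []) ∷ Δ 0 25 (25 ∷ 25 ∷ []) ∷ []) ∷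
  (Δ 7 1 (0 ∷ 1 ∷ []) ∷ Δ 0 13 (1 ∷ 13 ∷ []) ∷ Δ 0 23 (1 ∷ 23 ∷ []) ∷ []) ∷
  (Δ 5 0 (0 ∷ 0 ∷ []) ∷ Δ 1 6 (1 ∷ 6 ∷ []) ∷ Δ 0 29 (1 ∷ 29 ∷ []) ∷ []) ∷
  (Δ 6 1 (0 ∷ 1 ∷ []) ∷ Δ 0 16 (1 ∷ 16 ∷ []) ∷ Δ 0 23 (1 ∷ 23 ∷ []) ∷ []) ∷
  (Δ 0 0 (0 ∷ 0 ∷ []) ∷ Δ 5 1 (1 ∷ 1 ∷ []) ∷ Δ 0 29 (1 ∷ 29 ∷ []) ∷ []) ∷
  (Δ 2 4 (4 ∷ 4 ∷ []) ∷ Δ 1 6 (4 ∷ 6 ∷ []) ∷ Δ 0 34 (1 ∷ 34 ∷ []) ∷ []) ∷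
  (Δ 3 1 (1 ∷ 0 ∷ []) ∷ Δ 1 6 (4 ∷ 6 ∷ []) ∷ Δ 0 30 (2 ∷ 30 ∷ []) ∷ []) ∷
  (Δ 5 2 (1 ∷ 1 ∷ []) ∷ Δ 1 7 (1 ∷ 7 ∷ []) ∷ Δ 0 32 (1 ∷ 32 ∷ []) ∷ []) ∷
  (Δ 0 0 (0 ∷ 0 ∷ []) ∷ Δ 0 0 (0 ∷ 0 ∷ []) ∷ Δ 0 22 (1 ∷ 22 ∷ []) ∷ []) ∷
  (Δ 2 4 (1 ∷ 1 ∷ []) ∷ Δ 0 17 (1 ∷ 17 ∷ []) ∷ Δ 0 18 (1 ∷ 18 ∷ []) ∷ []) ∷
  (Δ 1 1 (0 ∷ 1 ∷ []) ∷ Δ 0 19 (1 ∷ 19 ∷ []) ∷ Δ 0 20 (1 ∷ 20 ∷ []) ∷ []) ∷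
  (Δ 3 1 (1 ∷ 1 ∷ []) ∷ Δ 0 17 (1 ∷ 17 ∷ []) ∷ Δ 0 24 (3 ∷ 24 ∷ []) ∷ []) ∷
  (Δ 0 3 (0 ∷ 3 ∷ []) ∷ Δ 0 18 (1 ∷ 18 ∷ []) ∷ Δ 0 19 (1 ∷ 19 ∷ []) ∷ []) ∷
  (Δ 2 6 (2 ∷ 2 ∷ []) ∷ Δ 1 9 (1 ∷ 9 ∷ []) ∷ Δ 0 26 (1 ∷ 26 ∷ []) ∷ []) ∷
  (Δ 1 1 (0 ∷ 1 ∷ []) ∷ Δ 0 19 (1 ∷ 19 ∷ []) ∷ Δ 0 22 (1 ∷ 22 ∷ []) ∷ []) ∷
  (Δ 2 2 (2 ∷ 2 ∷ []) ∷ Δ 1 15 (1 ∷ 15 ∷ []) ∷ Δ 0 28 (1 ∷ 28 ∷ []) ∷ []) ∷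
  (Δ 0 0 (0 ∷ 0 ∷ []) ∷ Δ 1 5 (1 ∷ 5 ∷ []) ∷ Δ 0 27 (1 ∷ 27 ∷ []) ∷ []) ∷
  (Δ 2 4 (1 ∷ 2 ∷ []) ∷ Δ 0 16 (1 ∷ 16 ∷ []) ∷ Δ 0 19 (1 ∷ 19 ∷ []) ∷ []) ∷
  (Δ 2 2 (2 ∷ 2 ∷ []) ∷ Δ 0 20 (9 ∷ 20 ∷ []) ∷ Δ 0 31 (1 ∷ 31 ∷ []) ∷ []) ∷
  (Δ 2 2 (2 ∷ 2 ∷ []) ∷ Δ 0 17 (1 ∷ 17 ∷ []) ∷ Δ 0 27 (3 ∷ 27 ∷ []) ∷ []) ∷
  (Δ 0 0 (0 ∷ 0 ∷ []) ∷ Δ 1 7 (7 ∷ 7 ∷ []) ∷ Δ 0 28 (28 ∷ 28 ∷ []) ∷ []) ∷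
  (Δ 2 6 (2 ∷ 2 ∷ []) ∷ Δ 1 8 (1 ∷ 8 ∷ []) ∷ Δ 0 28 (1 ∷ 28 ∷ []) ∷ []) ∷
  (Δ 2 1 (1 ∷ 1 ∷ []) ∷ Δ 1 8 (8 ∷ 7 ∷ []) ∷ Δ 0 31 (1 ∷ 31 ∷ []) ∷ []) ∷
  (Δ 2 5 (2 ∷ 2 ∷ []) ∷ Δ 1 10 (1 ∷ 10 ∷ []) ∷ Δ 0 30 (1 ∷ 30 ∷ []) ∷ []) ∷
  (Δ 0 0 (0 ∷ 0 ∷ []) ∷ Δ 0 0 (0 ∷ 0 ∷ []) ∷ Δ 0 25 (1 ∷ 25 ∷ []) ∷ []) ∷
  (Δ 4 3 (2 ∷ 2 ∷ []) ∷ Δ 0 15 (1 ∷ 15 ∷ []) ∷ Δ 1 24 (1 ∷ 24 ∷ []) ∷ []) ∷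
  (Δ 2 1 (0 ∷ 1 ∷ []) ∷ Δ 0 15 (1 ∷ 15 ∷ []) ∷ Δ 0 23 (1 ∷ 23 ∷ []) ∷ []) ∷
  (Δ 3 1 (1 ∷ 1 ∷ []) ∷ Δ 0 16 (1 ∷ 16 ∷ []) ∷ Δ 0 26 (5 ∷ 26 ∷ []) ∷ []) ∷
  (Δ 2 0 (0 ∷ 0 ∷ []) ∷ Δ 1 7 (1 ∷ 7 ∷ []) ∷ Δ 0 30 (11 ∷ 30 ∷ []) ∷ []) ∷
  (Δ 1 10 (1 ∷ 2 ∷ []) ∷ Δ 1 27 (25 ∷ 25 ∷ []) ∷ Δ 0 33 (9 ∷ 33 ∷ []) ∷ []) ∷
  (Δ 2 0 (0 ∷ 0 ∷ []) ∷ Δ 1 8 (8 ∷ 7 ∷ []) ∷ Δ 0 31 (1 ∷ 31 ∷ []) ∷ []) ∷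
  (Δ 3 2 (1 ∷ 1 ∷ []) ∷ Δ 1 12 (1 ∷ 12 ∷ []) ∷ Δ 0 32 (1 ∷ 32 ∷ []) ∷ []) ∷
  (Δ 0 0 (0 ∷ 0 ∷ []) ∷ Δ 1 2 (0 ∷ 2 ∷ []) ∷ Δ 0 28 (28 ∷ 28 ∷ []) ∷ []) ∷
  (Δ 3 2 (2 ∷ 1 ∷ []) ∷ Δ 0 12 (1 ∷ 12 ∷ []) ∷ Δ 0 30 (1 ∷ 30 ∷ []) ∷ []) ∷
  (Δ 3 1 (1 ∷ 1 ∷ []) ∷ Δ 0 14 (2 ∷ 14 ∷ []) ∷ Δ 0 30 (3 ∷ 30 ∷ []) ∷ []) ∷
  (Δ 3 2 (1 ∷ 1 ∷ []) ∷ Δ 0 14 (1 ∷ 14 ∷ []) ∷ Δ 0 29 (1 ∷ 29 ∷ []) ∷ []) ∷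
  (Δ 0 0 (0 ∷ 0 ∷ []) ∷ Δ 2 4 (3 ∷ 2 ∷ []) ∷ Δ 0 31 (1 ∷ 31 ∷ []) ∷ []) ∷
  (Δ 1 6 (1 ∷ 6 ∷ []) ∷ Δ 2 6 (3 ∷ 2 ∷ []) ∷ Δ 0 36 (1 ∷ 36 ∷ []) ∷ []) ∷
  (Δ 2 1 (0 ∷ 0 ∷ []) ∷ Δ 1 6 (4 ∷ 6 ∷ []) ∷ Δ 0 33 (3 ∷ 33 ∷ []) ∷ []) ∷
  (Δ 2 4 (4 ∷ 4 ∷ []) ∷ Δ 1 6 (4 ∷ 6 ∷ []) ∷ Δ 0 35 (1 ∷ 35 ∷ []) ∷ []) ∷
  (Δ 0 0 (0 ∷ 0 ∷ []) ∷ Δ 0 0 (0 ∷ 0 ∷ []) ∷ Δ 3 17 (1 ∷ 17 ∷ []) ∷ []) ∷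
  (Δ 1 8 (2 ∷ 8 ∷ []) ∷ Δ 1 12 (1 ∷ 12 ∷ []) ∷ Δ 0 17 (1 ∷ 17 ∷ []) ∷ []) ∷
  (Δ 2 0 (0 ∷ 0 ∷ []) ∷ Δ 5 15 (1 ∷ 15 ∷ []) ∷ Δ 0 21 (3 ∷ 21 ∷ []) ∷ []) ∷
  (Δ 1 5 (2 ∷ 5 ∷ []) ∷ Δ 0 19 (1 ∷ 19 ∷ []) ∷ Δ 0 24 (1 ∷ 24 ∷ []) ∷ []) ∷
  (Δ 0 0 (0 ∷ 0 ∷ []) ∷ Δ 0 17 (1 ∷ 17 ∷ []) ∷ Δ 0 19 (17 ∷ 19 ∷ []) ∷ []) ∷
  (Δ 1 6 (3 ∷ 2 ∷ []) ∷ Δ 2 14 (1 ∷ 14 ∷ []) ∷ Δ 0 26 (1 ∷ 26 ∷ []) ∷ []) ∷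
  (Δ 1 1 (0 ∷ 1 ∷ []) ∷ Δ 2 16 (1 ∷ 16 ∷ []) ∷ Δ 0 24 (1 ∷ 24 ∷ []) ∷ []) ∷
  (Δ 2 2 (2 ∷ 2 ∷ []) ∷ Δ 2 15 (1 ∷ 15 ∷ []) ∷ Δ 0 27 (1 ∷ 27 ∷ []) ∷ []) ∷
  (Δ 0 1 (1 ∷ 1 ∷ []) ∷ Δ 1 11 (1 ∷ 11 ∷ []) ∷ Δ 0 22 (3 ∷ 20 ∷ []) ∷ []) ∷
  (Δ 0 12 (1 ∷ 12 ∷ []) ∷ Δ 0 13 (3 ∷ 13 ∷ []) ∷ Δ 0 16 (9 ∷ 16 ∷ []) ∷ []) ∷
  (Δ 1 5 (2 ∷ 5 ∷ []) ∷ Δ 1 12 (1 ∷ 12 ∷ []) ∷ Δ 0 28 (1 ∷ 28 ∷ []) ∷ []) ∷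
  (Δ 1 7 (2 ∷ 6 ∷ []) ∷ Δ 1 11 (1 ∷ 11 ∷ []) ∷ Δ 0 29 (1 ∷ 29 ∷ []) ∷ []) ∷
  (Δ 0 0 (0 ∷ 0 ∷ []) ∷ Δ 1 11 (1 ∷ 11 ∷ []) ∷ Δ 0 23 (23 ∷ 23 ∷ []) ∷ []) ∷
  (Δ 1 4 (1 ∷ 4 ∷ []) ∷ Δ 3 12 (1 ∷ 12 ∷ []) ∷ Δ 0 27 (1 ∷ 27 ∷ []) ∷ []) ∷
  (Δ 1 0 (0 ∷ 0 ∷ []) ∷ Δ 2 13 (1 ∷ 13 ∷ []) ∷ Δ 0 30 (1 ∷ 30 ∷ []) ∷ []) ∷
  (Δ 1 4 (2 ∷ 4 ∷ []) ∷ Δ 1 12 (1 ∷ 12 ∷ []) ∷ Δ 0 33 (1 ∷ 33 ∷ []) ∷ []) ∷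
  (Δ 0 6 (3 ∷ 6 ∷ []) ∷ Δ 1 20 (7 ∷ 20 ∷ []) ∷ Δ 1 26 (20 ∷ 26 ∷ []) ∷ []) ∷
  (Δ 0 16 (10 ∷ 16 ∷ []) ∷ Δ 1 20 (7 ∷ 20 ∷ []) ∷ Δ 1 24 (22 ∷ 24 ∷ []) ∷ []) ∷
  (Δ 0 16 (3 ∷ 16 ∷ []) ∷ Δ 0 23 (23 ∷ 23 ∷ []) ∷ Δ 0 26 (9 ∷ 26 ∷ []) ∷ []) ∷
  (Δ 0 20 (7 ∷ 20 ∷ []) ∷ Δ 0 24 (22 ∷ 24 ∷ []) ∷ Δ 0 26 (10 ∷ 26 ∷ []) ∷ []) ∷
  (Δ 17 30 (28 ∷ 30 ∷ []) ∷ Δ 11 104 (85 ∷ 84 ∷ []) ∷ Δ 8 179 (90 ∷ 32 ∷ []) ∷ []) ∷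
  -- The exceptional pattern {1, 3, 5, 7}, from a simplex of dimension 6 times a tetrahedron.
  (Δ 11 50 (1 ∷ 1 ∷ 1 ∷ 1 ∷ 44 ∷ []) ∷ Δ 1 100 (2 ∷ 100 ∷ []) ∷ []) ∷
  (Δ 11 12 (7 ∷ 12 ∷ []) ∷ Δ 6 31 (11 ∷ 31 ∷ []) ∷ Δ 3 205 (103 ∷ 110 ∷ []) ∷ []) ∷
  (Δ 1 25 (1 ∷ 25 ∷ []) ∷ Δ 0 62 (21 ∷ 62 ∷ []) ∷ Δ 0 79 (1 ∷ 79 ∷ []) ∷ []) ∷
  (Δ 0 4 (4 ∷ 4 ∷ []) ∷ Δ 1 9 (4 ∷ 9 ∷ []) ∷ Δ 0 32 (1 ∷ 32 ∷ []) ∷ []) ∷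
  (Δ 1 8 (4 ∷ 7 ∷ []) ∷ Δ 0 11 (1 ∷ 11 ∷ []) ∷ Δ 0 32 (1 ∷ 32 ∷ []) ∷ []) ∷
  (Δ 1 11 (4 ∷ 11 ∷ []) ∷ Δ 0 23 (23 ∷ 4 ∷ []) ∷ Δ 0 28 (5 ∷ 28 ∷ []) ∷ []) ∷
  (Δ 1 11 (4 ∷ 10 ∷ []) ∷ Δ 0 19 (7 ∷ 19 ∷ []) ∷ Δ 0 24 (24 ∷ 23 ∷ []) ∷ []) ∷
  (Δ 0 2 (2 ∷ 2 ∷ []) ∷ Δ 1 11 (3 ∷ 9 ∷ []) ∷ Δ 0 33 (33 ∷ 33 ∷ []) ∷ []) ∷
  (Δ 0 7 (1 ∷ 7 ∷ []) ∷ Δ 1 12 (3 ∷ 12 ∷ []) ∷ Δ 0 51 (29 ∷ 51 ∷ []) ∷ []) ∷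
  (Δ 1 6 (4 ∷ 6 ∷ []) ∷ Δ 1 11 (3 ∷ 11 ∷ []) ∷ Δ 0 34 (1 ∷ 34 ∷ []) ∷ []) ∷
  (Δ 1 6 (4 ∷ 6 ∷ []) ∷ Δ 1 9 (4 ∷ 9 ∷ []) ∷ Δ 0 34 (1 ∷ 34 ∷ []) ∷ []) ∷
  (Δ 0 0 (0 ∷ 0 ∷ []) ∷ Δ 0 0 (0 ∷ 0 ∷ []) ∷ Δ 2 19 (19 ∷ 19 ∷ []) ∷ []) ∷
  (Δ 2 3 (1 ∷ 3 ∷ []) ∷ Δ 0 19 (1 ∷ 19 ∷ []) ∷ Δ 1 21 (1 ∷ 21 ∷ []) ∷ []) ∷
  (Δ 1 2 (1 ∷ 2 ∷ []) ∷ Δ 0 21 (1 ∷ 21 ∷ []) ∷ Δ 0 24 (1 ∷ 24 ∷ []) ∷ []) ∷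
  (Δ 2 2 (1 ∷ 2 ∷ []) ∷ Δ 1 18 (1 ∷ 18 ∷ []) ∷ Δ 0 25 (1 ∷ 25 ∷ []) ∷ []) ∷
  (Δ 0 0 (0 ∷ 0 ∷ []) ∷ Δ 0 16 (1 ∷ 16 ∷ []) ∷ Δ 0 20 (1 ∷ 20 ∷ []) ∷ []) ∷
  (Δ 1 6 (2 ∷ 3 ∷ []) ∷ Δ 1 18 (7 ∷ 18 ∷ []) ∷ Δ 0 24 (24 ∷ 22 ∷ []) ∷ []) ∷
  (Δ 1 0 (0 ∷ 0 ∷ []) ∷ Δ 0 18 (3 ∷ 18 ∷ []) ∷ Δ 0 27 (1 ∷ 27 ∷ []) ∷ []) ∷
  (Δ 2 2 (2 ∷ 2 ∷ []) ∷ Δ 1 17 (1 ∷ 17 ∷ []) ∷ Δ 0 28 (1 ∷ 28 ∷ []) ∷ []) ∷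
  (Δ 0 2 (1 ∷ 2 ∷ []) ∷ Δ 1 7 (7 ∷ 7 ∷ []) ∷ Δ 0 29 (29 ∷ 29 ∷ []) ∷ []) ∷
  (Δ 1 4 (3 ∷ 2 ∷ []) ∷ Δ 0 14 (1 ∷ 14 ∷ []) ∷ Δ 0 29 (1 ∷ 29 ∷ []) ∷ []) ∷
  (Δ 1 2 (1 ∷ 2 ∷ []) ∷ Δ 0 16 (10 ∷ 16 ∷ []) ∷ Δ 0 34 (34 ∷ 34 ∷ []) ∷ []) ∷
  (Δ 1 3 (1 ∷ 3 ∷ []) ∷ Δ 0 21 (1 ∷ 21 ∷ []) ∷ Δ 0 25 (1 ∷ 25 ∷ []) ∷ []) ∷
  (Δ 0 0 (0 ∷ 0 ∷ []) ∷ Δ 1 8 (7 ∷ 8 ∷ []) ∷ Δ 0 29 (29 ∷ 29 ∷ []) ∷ []) ∷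
  (Δ 1 6 (3 ∷ 2 ∷ []) ∷ Δ 1 15 (1 ∷ 15 ∷ []) ∷ Δ 0 26 (1 ∷ 26 ∷ []) ∷ []) ∷
  (Δ 1 0 (0 ∷ 0 ∷ []) ∷ Δ 1 13 (1 ∷ 13 ∷ []) ∷ Δ 0 33 (1 ∷ 33 ∷ []) ∷ []) ∷
  (Δ 1 6 (2 ∷ 6 ∷ []) ∷ Δ 1 8 (4 ∷ 8 ∷ []) ∷ Δ 0 36 (1 ∷ 36 ∷ []) ∷ []) ∷
  (Δ 0 0 (0 ∷ 0 ∷ []) ∷ Δ 0 0 (0 ∷ 0 ∷ []) ∷ Δ 0 34 (1 ∷ 34 ∷ []) ∷ []) ∷
  (Δ 3 3 (2 ∷ 2 ∷ []) ∷ Δ 0 18 (1 ∷ 18 ∷ []) ∷ Δ 1 30 (1 ∷ 30 ∷ []) ∷ []) ∷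
  (Δ 1 2 (1 ∷ 0 ∷ []) ∷ Δ 0 14 (14 ∷ 14 ∷ []) ∷ Δ 0 33 (1 ∷ 33 ∷ []) ∷ []) ∷
  (Δ 1 7 (4 ∷ 7 ∷ []) ∷ Δ 0 17 (1 ∷ 17 ∷ []) ∷ Δ 0 32 (1 ∷ 32 ∷ []) ∷ []) ∷
  (Δ 1 0 (0 ∷ 0 ∷ []) ∷ Δ 0 12 (1 ∷ 12 ∷ []) ∷ Δ 0 33 (1 ∷ 33 ∷ []) ∷ []) ∷
  (Δ 17 81 (22 ∷ 37 ∷ []) ∷ Δ 13 133 (7 ∷ 111 ∷ []) ∷ Δ 13 161 (18 ∷ 161 ∷ []) ∷ []) ∷
  (Δ 1 1 (1 ∷ 0 ∷ []) ∷ Δ 0 14 (1 ∷ 14 ∷ []) ∷ Δ 0 35 (1 ∷ 35 ∷ []) ∷ []) ∷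
  (Δ 2 1 (1 ∷ 1 ∷ []) ∷ Δ 0 18 (1 ∷ 18 ∷ []) ∷ Δ 0 42 (1 ∷ 42 ∷ []) ∷ []) ∷
  (Δ 0 1 (1 ∷ 1 ∷ []) ∷ Δ 1 6 (2 ∷ 6 ∷ []) ∷ Δ 0 32 (2 ∷ 32 ∷ []) ∷ []) ∷
  (Δ 2 4 (4 ∷ 4 ∷ []) ∷ Δ 0 10 (1 ∷ 10 ∷ []) ∷ Δ 0 34 (1 ∷ 34 ∷ []) ∷ []) ∷
  (Δ 1 5 (5 ∷ 3 ∷ []) ∷ Δ 0 13 (1 ∷ 13 ∷ []) ∷ Δ 0 34 (1 ∷ 34 ∷ []) ∷ []) ∷
  (Δ 1 5 (5 ∷ 2 ∷ []) ∷ Δ 0 15 (1 ∷ 15 ∷ []) ∷ Δ 0 33 (1 ∷ 33 ∷ []) ∷ []) ∷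
  (Δ 0 0 (0 ∷ 0 ∷ []) ∷ Δ 1 6 (6 ∷ 6 ∷ []) ∷ Δ 0 33 (1 ∷ 33 ∷ []) ∷ []) ∷
  (Δ 1 6 (2 ∷ 5 ∷ []) ∷ Δ 1 6 (6 ∷ 6 ∷ []) ∷ Δ 0 37 (1 ∷ 37 ∷ []) ∷ []) ∷
  (Δ 1 6 (2 ∷ 6 ∷ []) ∷ Δ 1 7 (2 ∷ 7 ∷ []) ∷ Δ 0 36 (36 ∷ 35 ∷ []) ∷ []) ∷
  (Δ 1 6 (2 ∷ 6 ∷ []) ∷ Δ 1 8 (4 ∷ 8 ∷ []) ∷ Δ 0 37 (1 ∷ 37 ∷ []) ∷ []) ∷
  []

-- A closed Boolean: the type checker computes all 128 products and their signs, and the type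
-- reduces to the unit type.
table-realises : T (allRealised (patterns 7) table)
table-realises = _

realisation : ∀ s → ∃ λ Ss → T (realises s Ss)
realisation s = allRealised⇒realises (patterns 7) table table-realises (∈-patterns s)

-- From prescribed indices to a sign pattern and its polytope

module _ {q} (is : Vec ℕ q) (bounds : ∀ a → 1 ≤ lookup is a × lookup is a ≤ 7) where

  marked? : ∀ k → Dec (∃ λ a → k ≡ lookup is a)
  marked? k = Finₚ.any? (λ a → k ℕ.≟ lookup is a)

  pattern-of : Vec Bool 7
  pattern-of = Vec.tabulate (λ k → does (marked? (suc (toℕ k))))

  unmarked : ∀ {k} → (∀ a → lookup is a ≢ k) → false ≡ does (marked? k)
  unmarked {k} ≢k = sym (dec-false (marked? k) λ (a , eq) → ≢k a (sym eq))

  -- The seven middle entries agree by computation; at 0, 8 and 9 the fixed `false` is right because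
  -- `bounds` keeps the indices between 1 and 7.
  lookup-extended : ∀ k → lookup (extended pattern-of) k ≡ does (marked? (toℕ k))
  lookup-extended 0F = unmarked λ a → ℕₚ.>⇒≢ (proj₁ (bounds a))
  lookup-extended 1F = refl
  lookup-extended 2F = refl
  lookup-extended 3F = refl
  lookup-extended 4F = refl
  lookup-extended 5F = refl
  lookup-extended 6F = refl
  lookup-extended 7F = refl
  lookup-extended 8F = unmarked λ a → ℕₚ.<⇒≢ (s≤s (proj₂ (bounds a)))
  lookup-extended 9F = unmarked λ a → ℕₚ.<⇒≢ (s≤s (ℕₚ.m≤n⇒m≤1+n (proj₂ (bounds a))))

  module _ (Ss : List Simplex) (realised : T (realises pattern-of Ss)) where

    dimension≡9 : dimension Ss ≡ 9
    dimension≡9 = ℕₚ.≡ᵇ⇒≡ (dimension Ss) 9 (proj₁ (Equivalence.to (T-∧ {dimension Ss ℕ.≡ᵇ 9}) realised))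

    signs : T (hasSigns (extended pattern-of) (productPoly Ss))
    signs = proj₂ (Equivalence.to (T-∧ {dimension Ss ℕ.≡ᵇ 9}) realised)

    sign : ∀ k {b} → does (marked? (toℕ k)) ≡ b → T (hasSign b (coefficient (productPoly Ss) (toℕ k)))
    sign k eq = subst (λ b → T (hasSign b (coefficient (productPoly Ss) (toℕ k)))) (trans (lookup-extended k) eq)
      (hasSigns⇒hasSign (extended pattern-of) (productPoly Ss) signs k)

    -- Here `Ss` is a variable and `realised` a hypothesis, so no row of the table is evaluated
    -- again.
    prescribedSigns : Σ ℕ λ N → Σ (IntegralPolytope N) λ P → HasDim P 9 ×
      Σ (Fin 10 → ℚ) λ c → IsEhrhart P c ×
        (∀ (k : Fin 10) →
          ((∃ λ a → toℕ k ≡ lookup is a) → c k <ℚ 0ℚ) ×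
          (¬ (∃ λ a → toℕ k ≡ lookup is a) → 0ℚ <ℚ c k))
    prescribedSigns = dimension Ss , product Ss ,
      subst (HasDim (product Ss)) dimension≡9 (fullDimensional⇒hasDim {P = product Ss} (fullDimensional-product Ss)) ,
      ehrhartCoefficient Ss ∘ toℕ ,
      isEhrhart-product Ss (ℕₚ.≤-reflexive (hasSigns⇒length (extended pattern-of) (productPoly Ss) signs)) ,
      λ k → (λ hit → ehrhartCoefficient-neg Ss (toℕ k) (sign k (dec-true (marked? (toℕ k)) hit))) ,
            (λ ¬hit → ehrhartCoefficient-pos Ss (toℕ k) (sign k (dec-false (marked? (toℕ k)) ¬hit)))

theorem6p8 : (q : ℕ) → 1 ≤ q → (is : Vec ℕ q) → StrictlyIncreasing is →
    (∀ a → 1 ≤ lookup is a × lookup is a ≤ 7) →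
    Σ ℕ λ N → Σ (IntegralPolytope N) λ P → HasDim P 9 ×
    Σ (Fin 10 → ℚ) λ c → IsEhrhart P c ×
    (∀ (k : Fin 10) →
    ((∃ λ a → toℕ k ≡ lookup is a) → c k <ℚ 0ℚ) ×
    (¬ (∃ λ a → toℕ k ≡ lookup is a) → 0ℚ <ℚ c k))
theorem6p8 q _ is _ bounds = let Ss , realised = realisation (pattern-of is bounds) in prescribedSigns is bounds Ss realised
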